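{- Every triangle-free planar graph $G$ with at least two vertices satisfies $\rho_2(G)\ge 1/723636$.
   Context: Firefighter process: in a finite simple graph $G$, a fire starts at time $0$ at a vertex $v$. At each subsequent time step, the firefighters first protect at most $k$ vertices that are not burning (protection is permanent), and then the fire spreads from every burning vertex to all its unprotected neighbours. A vertex is saved if it never burns. Let $sn_k(G,v)$ be the maximum number of vertices of $G$ that can be saved when the fire starts at $v$. For a graph $G$ on $n$ vertices, the $k$-surviving rate is $\rho_k(G)=\frac{1}{n^2}\sum_{v\in V(G)} sn_k(G,v)$. -}

module Defs where

open import Data.Fin.Base using (Fin)
open import Data.Fin.Properties using (any?)
open import Data.Fin.Subset using (Subset; inside; ⊥; ⁅_⁆; ∁; _∪_; _∈_; _∉_; _⊆_; ∣_∣)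
open import Data.Fin.Subset.Properties
open import Data.Integer.Base using (+_)
open import Data.List.Base using (map; allFin)
open import Data.Nat.Base using (ℕ; zero; suc; _+_; _*_; _^_; _≤_; z≤n; s≤s; s≤s⁻¹; NonZero)
open import Data.Nat.ListAction using (sum)
open import Data.Nat.Properties using (_≤?_; ≤-refl; ≤-reflexive; ≤-trans; ≤-antisym; ≤∧≢⇒<; +-comm; m^n≢0)
open import Data.Product.Base using (∃; ∃-syntax; _×_; _,_; proj₁; proj₂)
open import Data.Rational.Unnormalised.Base using (ℚᵘ; _/_)
open import Data.Sum.Base using (_⊎_; inj₁; inj₂)
open import Data.Vec.Base using (tabulate)
open import Data.Vec.Properties using (lookup∘tabulate; lookup⇒[]=; []=⇒lookup)
open import Function.Base using (_∘_)
open import Function.Bundles using (Inverse; _⇔_; mk⇔; Equivalence)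
open import Level using (0ℓ)
open import Relation.Binary.Bundles using (Setoid)
open import Relation.Binary.Core using (Rel)
open import Relation.Binary.Construct.Closure.Equivalence using (setoid)
open import Relation.Binary.Construct.Closure.ReflexiveTransitive using (Star)
open import Relation.Binary.Definitions using (Decidable; Symmetric; Irreflexive)
open import Relation.Binary.PropositionalEquality
  using (_≡_; refl; sym; trans; cong; cong₂; subst) renaming (setoid to ≡-setoid)
open import Relation.Nullary using (¬_; Dec; yes; no; does; contradiction)
open import Relation.Nullary.Decidable using (_×-dec_; _⊎-dec_; ¬?; dec-true; map′; decidable-stable)

record Graph (n : ℕ) : Set₁ where
  field
    Adj        : Rel (Fin n) 0ℓ
    adj?       : Decidable Adj
    adj-sym    : Symmetric Adj
    adj-irrefl : Irreflexive _≡_ Adj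

TriangleFree : ∀ {n} → Graph n → Set
TriangleFree G = ∀ {u v w} → Adj u v → Adj v w → ¬ Adj w u
  where open Graph G

-- In the absence of the real plane, an embedding in the sphere is given
-- combinatorially, by a rotation system (Heffter, Edmonds): a cyclic
-- ordering of the neighbours of every vertex.  Rotation systems correspond
-- to the cellular embeddings of a graph in oriented closed surfaces (one
-- surface for each connected component), and a graph is planar when every
-- such surface can be taken to be a sphere.

-- S has exactly k equivalence classes.
HasClasses : Setoid 0ℓ 0ℓ → ℕ → Set
HasClasses S k = Inverse S (≡-setoid (Fin k))

module _ {n} (G : Graph n) where
  open Graph G

  -- next u v is the successor of v in the cyclic ordering around u; its
  -- values are irrelevant unless Adj u v.
  record Rotation : Set where
    field
      next     : Fin n → Fin n → Fin n
      next-adj : ∀ {u v} → Adj u v → Adj u (next u v)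
      cyclic   : ∀ {u v w} → Adj u v → Adj u w → Star (λ x y → next u x ≡ y) v w

  record Dart : Set where
    constructor dart
    field
      {source target} : Fin n
      adj             : Adj source target

  -- Both orientations of an edge are identified, and so are different
  -- proofs of the same adjacency.
  data Reversal : Rel Dart 0ℓ where
    reversal : ∀ {u v} (p : Adj u v) (q : Adj v u) → Reversal (dart p) (dart q)

  Components Edges : Setoid 0ℓ 0ℓ
  Components = setoid Adj
  Edges      = setoid Reversal

  -- The facial walks of a rotation system.  A facial walk arriving at v
  -- from u continues to the neighbour of v following u.  An isolated vertex,
  -- embedded alone in its sphere, bounds one face, having a trivial walk.
  data Side : Set where
    along  : Dart → Side
    around : ∀ v → (∀ w → ¬ Adj v w) → Side

  module _ (R : Rotation) where
    open Rotation R

    data FaceStep : Rel Side 0ℓ where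
      turn : ∀ {u v w} (p : Adj u v) (q : Adj v w) → next v u ≡ w →
             FaceStep (along (dart p)) (along (dart q))
      stay : ∀ {v} i j → FaceStep (around v i) (around v j)

    Faces : Setoid 0ℓ 0ℓ
    Faces = setoid FaceStep

    -- Each component satisfies V - E + F ≤ 2, with equality exactly for the
    -- sphere.  Hence all the surfaces are spheres if and only if the total
    -- Euler characteristic is twice the number of components.
    record Spherical : Set where
      field
        E F C      : ℕ
        edges      : HasClasses Edges E
        faces      : HasClasses Faces F
        components : HasClasses Components C
        euler      : n + F ≡ E + 2 * C

  Planar : Set
  Planar = ∃ Spherical

-- The set protected at time step t + 1 is σ t.  The fire is deterministic,
-- so a strategy need not refer to the past.
Strategy : ℕ → Set
Strategy n = ℕ → Subset n

module _ {n} (G : Graph n) where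
  open Graph G

  -- w burns after one more step, when B burns and P is protected.
  Burns : Subset n → Subset n → Fin n → Set
  Burns B P w = w ∈ B ⊎ (w ∉ P × ∃[ u ] (u ∈ B × Adj u w))

  burns? : ∀ B P w → Dec (Burns B P w)
  burns? B P w = w ∈? B ⊎-dec (¬? (w ∈? P) ×-dec any? λ u → u ∈? B ×-dec adj? u w)

  spread : Subset n → Subset n → Subset n
  spread B P = tabulate λ w → does (burns? B P w)

  -- The process in which B₀ burns and P₀ is protected at time 0.
  module Process (B₀ P₀ : Subset n) (σ : Strategy n) where

    protected : ℕ → Subset n
    protected zero    = P₀
    protected (suc t) = protected t ∪ σ t

    burning : ℕ → Subset n
    burning zero    = B₀
    burning (suc t) = spread (burning t) (protected (suc t))

    Legal : ℕ → Set
    Legal k = ∀ t → ∣ σ t ∣ ≤ k × σ t ⊆ ∁ (burning t)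

    IsSaved : Subset n → Set
    IsSaved S = ∀ w → w ∈ S ⇔ (∀ t → w ∉ burning t)

  CanSave : ℕ → Fin n → ℕ → Set
  CanSave k v m = ∃[ σ ] (Process.Legal ⁅ v ⁆ ⊥ σ k ×
                  ∃[ S ] (Process.IsSaved ⁅ v ⁆ ⊥ σ S × ∣ S ∣ ≡ m))

  IsMaxSaved : ℕ → Fin n → ℕ → Set
  IsMaxSaved k v m = CanSave k v m × (∀ {m′} → CanSave k v m′ → m′ ≤ m)

private
  greatest : ∀ {P : ℕ → Set} → (∀ m → Dec (P m)) → P 0 → ∀ b → (∀ {m} → P m → m ≤ b) →
             ∃[ m ] (P m × (∀ {m′} → P m′ → m′ ≤ m))
  greatest P? p0 zero bound = 0 , p0 , bound
  greatest P? p0 (suc b) bound with P? (suc b)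
  ... | yes p = suc b , p , bound
  ... | no ¬p = greatest P? p0 b λ p →
                  s≤s⁻¹ (≤∧≢⇒< (bound p) λ { refl → ¬p p })

module _ {n} (G : Graph n) where
  open Graph G

  spread⁺ : ∀ B P {w} → Burns G B P w → w ∈ spread G B P
  spread⁺ B P {w} b = lookup⇒[]= w _ (trans (lookup∘tabulate _ w) (dec-true (burns? G B P w) b))

  spread⁻ : ∀ B P {w} → w ∈ spread G B P → Burns G B P w
  spread⁻ B P {w} w∈ = witness (burns? G B P w) (trans (sym (lookup∘tabulate _ w)) ([]=⇒lookup w∈))
    where
    witness : ∀ {A : Set} (a? : Dec A) → does a? ≡ inside → A
    witness (yes a) _ = a

  module _ (B₀ P₀ : Subset n) (σ : Strategy n) where
    open Process G B₀ P₀ σ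

    burning-mono : ∀ t → burning t ⊆ burning (suc t)
    burning-mono t = spread⁺ _ _ ∘ inj₁

    Stopped : ℕ → Set
    Stopped t = burning (suc t) ⊆ burning t

    stopped-suc : ∀ t → Stopped t → Stopped (suc t)
    stopped-suc t stop w∈ with spread⁻ _ (protected (suc (suc t))) w∈
    ... | inj₁ b = b
    ... | inj₂ (w∉ , u , u∈ , uw) =
      spread⁺ _ (protected (suc t)) (inj₂ (w∉ ∘ p⊆p∪q _ , u , stop u∈ , uw))

    stopped-or-large : ∀ t → Stopped t ⊎ t ≤ ∣ burning t ∣
    stopped-or-large zero = inj₂ z≤n
    stopped-or-large (suc t) with stopped-or-large t
    ... | inj₁ stop = inj₁ (stopped-suc t stop)
    ... | inj₂ large with burning t ⊂? burning (suc t)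
    ...   | yes t⊂ = inj₂ (≤-trans (s≤s large) (p⊂q⇒∣p∣<∣q∣ t⊂))
    ...   | no t⊄ = inj₁ (stopped-suc t λ {w} w∈ → decidable-stable (w ∈? burning t)
                      λ w∉ → t⊄ (burning-mono t , w , w∈ , w∉))

    stopped : Stopped n
    stopped with stopped-or-large n
    ... | inj₁ stop = stop
    ... | inj₂ large = λ _ → subst (_ ∈_) (sym all-burnt) ∈⊤
      where all-burnt = ∣p∣≡n⇒p≡⊤ (≤-antisym (∣p∣≤n (burning n)) large)

    burning⊆final : ∀ t → burning t ⊆ burning n
    burning⊆final t {w} = beyond t ∘ subst (λ i → w ∈ burning i) (+-comm n t) ∘ later n
      where
      later : ∀ i {w} → w ∈ burning t → w ∈ burning (i + t)
      later zero    = λ w∈ → w∈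
      later (suc i) = burning-mono (i + t) ∘ later i

      stays : ∀ i → Stopped (i + n)
      stays zero    = stopped
      stays (suc i) = stopped-suc (i + n) (stays i)

      beyond : ∀ i {w} → w ∈ burning (i + n) → w ∈ burning n
      beyond zero    = λ w∈ → w∈
      beyond (suc i) = beyond i ∘ stays i

    final-saved : IsSaved (∁ (burning n))
    final-saved w = mk⇔ (λ w∈ t → x∈∁p⇒x∉p w∈ ∘ burning⊆final t) (λ safe → x∉p⇒x∈∁p (safe n))

    saved-unique : ∀ {S} → IsSaved S → S ≡ ∁ (burning n)
    saved-unique S-saved = ⊆-antisym
      (λ {w} → Equivalence.from (final-saved w) ∘ Equivalence.to (S-saved w))
      (λ {w} → Equivalence.from (S-saved w) ∘ Equivalence.to (final-saved w))

  module _ (B P : Subset n) (σ : Strategy n) where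
    private
      P′ = P ∪ σ 0
      B′ = spread G B P′
      module Whole = Process G B P σ
      module Rest  = Process G B′ P′ (σ ∘ suc)

    protected-suc : ∀ t → Whole.protected (suc t) ≡ Rest.protected t
    protected-suc zero    = refl
    protected-suc (suc t) = cong (_∪ σ (suc t)) (protected-suc t)

    burning-suc : ∀ t → Whole.burning (suc t) ≡ Rest.burning t
    burning-suc zero    = refl
    burning-suc (suc t) = cong₂ (spread G) (burning-suc t) (protected-suc (suc t))

  module _ (k : ℕ) where

    CanSaveIn : ℕ → Subset n → Subset n → ℕ → Set
    CanSaveIn f B P m = ∃[ σ ] (Process.Legal G B P σ k × m ≤ ∣ ∁ (Process.burning G B P σ f) ∣)

    idle : Strategy n
    idle _ = ⊥

    idle-legal : ∀ B P → Process.Legal G B P idle k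
    idle-legal B P t = subst (_≤ k) (sym (∣⊥∣≡0 n)) z≤n , λ w∈ → contradiction w∈ ∉⊥

    canSaveIn? : ∀ f B P m → Dec (CanSaveIn f B P m)
    canSaveIn? zero B P m =
      map′ (λ m≤ → idle , idle-legal B P , m≤) (proj₂ ∘ proj₂) (m ≤? ∣ ∁ B ∣)
    canSaveIn? (suc f) B P m =
      map′ join split (anySubset? λ s →
        (∣ s ∣ ≤? k ×-dec s ⊆? ∁ B) ×-dec canSaveIn? f (spread G B (P ∪ s)) (P ∪ s) m)
      where
      join : ∃[ s ] ((∣ s ∣ ≤ k × s ⊆ ∁ B) × CanSaveIn f (spread G B (P ∪ s)) (P ∪ s) m) →
             CanSaveIn (suc f) B P m
      join (s , first , σ , legal , m≤) =
        σ′ , legal′ , subst (λ b → m ≤ ∣ ∁ b ∣) (sym (burning-suc B P σ′ f)) m≤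
        where
        σ′ : Strategy n
        σ′ zero    = s
        σ′ (suc t) = σ t

        legal′ : Process.Legal G B P σ′ k
        legal′ zero    = first
        legal′ (suc t) = subst (λ b → ∣ σ t ∣ ≤ k × σ t ⊆ ∁ b) (sym (burning-suc B P σ′ t)) (legal t)

      split : CanSaveIn (suc f) B P m →
              ∃[ s ] ((∣ s ∣ ≤ k × s ⊆ ∁ B) × CanSaveIn f (spread G B (P ∪ s)) (P ∪ s) m)
      split (σ , legal , m≤) =
        σ 0 , legal 0 , σ ∘ suc ,
        (λ t → subst (λ b → ∣ σ (suc t) ∣ ≤ k × σ (suc t) ⊆ ∁ b) (burning-suc B P σ t) (legal (suc t))) ,
        subst (λ b → m ≤ ∣ ∁ b ∣) (burning-suc B P σ f) m≤

    maxSaved : ∀ v → ∃ (IsMaxSaved G k v)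
    maxSaved v
      with greatest (canSaveIn? n ⁅ v ⁆ ⊥) (idle , idle-legal _ _ , z≤n) n
             (λ (σ , _ , m≤) → ≤-trans m≤ (∣p∣≤n (∁ (Process.burning G ⁅ v ⁆ ⊥ σ n))))
    ... | m , (σ , legal , m≤) , largest =
      m , (σ , legal , _ , final-saved _ _ σ , ≤-antisym (largest (σ , legal , ≤-refl)) m≤) ,
      λ (σ′ , legal′ , S , S-saved , ∣S∣≡) →
        largest (σ′ , legal′ ,
                 ≤-reflexive (trans (sym ∣S∣≡) (cong ∣_∣ (saved-unique _ _ σ′ S-saved))))

sn : ∀ {n} → ℕ → Graph n → Fin n → ℕ
sn k G v = proj₁ (maxSaved G k v)

sn-isMax : ∀ {n} k (G : Graph n) v → IsMaxSaved G k v (sn k G v)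
sn-isMax k G v = proj₂ (maxSaved G k v)

ρ : ∀ {n} → .{{NonZero n}} → ℕ → Graph n → ℚᵘ
ρ {n} k G = + sum (map (sn k G) (allFin n)) / n ^ 2
  where instance _ = m^n≢0 n 2

-- A vertex v of degree at most 3 saves about n/3 vertices, in any planar
-- graph.  Take a breadth-first tree rooted at v and the walk along its
-- contour.  By Euler's formula the edges outside the tree are non-crossing
-- chords of this walk.  Hence two corners x, y of a common face cut the walk
-- into two parts, which are separated by the tree paths from v to x and to y,
-- and, as for planar separators, x and y can be chosen such that both parts
-- visit at least n/3 vertices.  The paths are protected layer by layer, ahead
-- of the fire, and as v has at most three neighbours, two firefighters
-- suffice in the first step to keep the fire out of one of the parts.
--
-- If only few vertices have degree at most 3, then, by Euler's formula and
-- since there are no triangles, all but few vertices are surrounded by a patch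
-- of the square grid.  Two firefighters contain a fire in the grid to 18
-- cells, and their strategy can be copied along the map from the grid to the
-- patch even if this map is not injective.
module Submission where

open import Defs

-- A dart, unlike a vertex, tells which direction is east, so the moves across a patch are
-- permutations of the darts. Hence each of the 49 positions of a 7 by 7 patch is irregular for no
-- more darts than there are irregular darts in all. These number at most 40 for each vertex of
-- degree at most 3. Every other vertex and almost every face has a cycle of at least 4 darts.
-- Counting 20 for each vertex and face and 5 for each dart at either end makes the main terms
-- cancel in Euler's formula. An unsafe vertex has at least 4 darts, so `n` is at most 1 + 49 * 40 /
-- 4 = 491 times the number of safe vertices. For `n ≥ 24` each of them saves at least `n / 4`
-- vertices, which gives 1/1964, more than is claimed; for smaller `n` one saved vertex for each
-- fire is enough. That a chord separates the sphere is a Jordan curve theorem, and has to be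
-- extracted from `euler`. This equation counts all components at once, so a spanning forest is
-- needed, although the fire sees only one tree.

module Survival where

  open import Algebra.Properties.CommutativeMonoid.Sum using ()
  open import Data.Bool.Base using (if_then_else_)
  open import Data.Fin.Base using (Fin; zero; suc; toℕ; fromℕ<; punchIn; punchOut) renaming (_<_ to _<ᶠ_)
  open import Data.Fin.Properties
    using (_≟_; any?; *↔×; injective⇒≤; pigeonhole; punchInᵢ≢i; punchOut-cong; punchOut-injective;
           punchOut-punchIn; suc-injective; toℕ-fromℕ<)
    renaming (_<?_ to _<ᶠ?_; <-asym to <ᶠ-asym; <-cmp to <ᶠ-cmp)
  open import Data.Fin.Subset using (Subset; _∈_; _∉_; ∁; ∣_∣; ⁅_⁆) renaming (⊥ to ∅)
  open import Data.Fin.Subset.Properties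
    using (x∈⁅x⁆; x∈⁅y⁆⇒x≡y; ∣⁅x⁆∣≡1; x∉p⇒x∈∁p; p⊆p∪q; q⊆p∪q; p⊆q⇒∣p∣≤∣q∣)
  open import Data.List.Base as List using (List; []; _∷_; allFin; upTo)
  open import Data.List.Membership.Propositional using (find; lose) renaming (_∈_ to _∈ᴸ_)
  open import Data.List.Membership.Propositional.Properties using (∈-upTo⁺; ∈-upTo⁻)
  open import Data.List.Properties using (map-tabulate)
  open import Data.List.Relation.Unary.All as All using (All; []; _∷_)
  open import Data.List.Relation.Unary.AllPairs using ([]; _∷_)
  open import Data.List.Relation.Unary.Any as Any using (Any; here; there)
  open import Data.List.Relation.Unary.Any.Properties using (map⁺)
  open import Data.List.Relation.Unary.Unique.Propositional using (Unique)
  open import Data.Nat.Base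
  open import Data.Nat.DivMod using (m≡m%n+[m/n]*n; m%n<n; m/n*n≤m; /-monoˡ-≤)
  open import Data.Nat.GeneralisedArithmetic using (fold; iterate)
  open import Data.Nat.ListAction using () renaming (sum to ℕ-sum)
  open import Data.Nat.Properties as ℕ hiding (_≟_; suc-injective)
  open import Data.Nat.Tactic.RingSolver using (solve-∀)
  open import Data.Product.Base using (_×_; _,_; ∃; ∃-syntax; proj₁; proj₂; swap)
  open import Data.Product.Function.NonDependent.Propositional using (_×-↔_)
  open import Data.Product.Properties using (,-injectiveˡ; ,-injectiveʳ; ≡-dec)
  open import Data.Sum.Base as Sum using (_⊎_; inj₁; inj₂)
  open import Data.Unit.Base using (⊤; tt)
  open import Data.Vec.Base using (tabulate)
  open import Data.Vec.Properties using (lookup∘tabulate; lookup⇒[]=; []=⇒lookup)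
  open import Function.Base using (_∘_; id)
  open import Function.Bundles using (_↔_; Inverse)
  open import Function.Construct.Composition using (_↔-∘_)
  open import Function.Construct.Identity using (↔-id)
  open import Function.Construct.Symmetry using (↔-sym)
  open import Function.Definitions using (Injective)
  open import Level using (0ℓ)
  open import Relation.Binary.Bundles using (Setoid)
  open import Relation.Binary.Construct.Closure.Equivalence using (return)
  open import Relation.Binary.Construct.Closure.ReflexiveTransitive using (Star; ε; _◅_)
  open import Relation.Binary.Construct.Closure.Symmetric using (bwd; fwd)
  open import Relation.Binary.Definitions using (DecidableEquality; Tri; tri<; tri≈; tri>)
  open import Relation.Binary.PropositionalEquality
  open import Relation.Nullary using (¬_; Dec; yes; no; does; contradiction)
  open import Relation.Nullary.Decidable using (¬?; _×-dec_; _⊎-dec_; dec-true; decidable-stable; toWitness)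
  open import Relation.Unary using (Pred; Decidable)
  open Algebra.Properties.CommutativeMonoid.Sum +-0-commutativeMonoid
      using (sum; ∑-distrib-+; ∑-comm; sum-cong-≗)

  -- Finite sums and counting

  ind : ∀ {P : Set} → Dec P → ℕ
  ind P? = if does P? then 1 else 0

  ind-mono : ∀ {P Q : Set} (P? : Dec P) (Q? : Dec Q) → (P → Q) → ind P? ≤ ind Q?
  ind-mono (no _)  _       _ = z≤n
  ind-mono (yes _) (yes _) _ = ≤-refl
  ind-mono (yes p) (no ¬q) f = contradiction (f p) ¬q

  sum-mono : ∀ {n} {f g : Fin n → ℕ} → (∀ i → f i ≤ g i) → sum f ≤ sum g
  sum-mono {zero}  f≤g = z≤n
  sum-mono {suc n} f≤g = +-mono-≤ (f≤g zero) (sum-mono (f≤g ∘ suc))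

  sum-const : ∀ n {c} → sum {n} (λ _ → c) ≡ n * c
  sum-const zero    = refl
  sum-const (suc n) = cong (_ +_) (sum-const n)

  sum-*ˡ : ∀ {n} c (f : Fin n → ℕ) → sum (λ i → c * f i) ≡ c * sum f
  sum-*ˡ {zero}  c f = sym (*-zeroʳ c)
  sum-*ˡ {suc n} c f = trans (cong (c * f zero +_) (sum-*ˡ c (f ∘ suc))) (sym (*-distribˡ-+ c (f zero) _))

  sum-δ : ∀ {n} (f : Fin n → ℕ) j → sum (λ i → ind (j ≟ i) * f i) ≡ f j
  sum-δ {suc n} f zero    =
    trans (cong₂ _+_ (+-identityʳ (f zero)) (trans (sum-const n) (*-zeroʳ n))) (+-identityʳ (f zero))
  sum-δ {suc n} f (suc j) = sum-δ (f ∘ suc) j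

  -- Splitting off one summand leaves the value zero behind instead of
  -- shortening the sum, so that the index type does not change.
  except : ∀ {n} → Fin n → (Fin n → ℕ) → Fin n → ℕ
  except j f i = if does (j ≟ i) then 0 else f i

  except-≢ : ∀ {n} {j i : Fin n} (f : Fin n → ℕ) → j ≢ i → except j f i ≡ f i
  except-≢ {j = j} {i} f j≢i with j ≟ i
  ... | yes j≡i = contradiction j≡i j≢i
  ... | no _    = refl

  sum-except : ∀ {n} (f : Fin n → ℕ) j → f j + sum (except j f) ≡ sum f
  sum-except f j = begin
    f j + sum (except j f)                                 ≡⟨ cong (_+ sum (except j f)) (sum-δ f j) ⟨
    sum (λ i → ind (j ≟ i) * f i) + sum (except j f)
        ≡⟨ ∑-distrib-+ (λ i → ind (j ≟ i) * f i) (except j f) ⟨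
    sum (λ i → ind (j ≟ i) * f i + except j f i)           ≡⟨ sum-cong-≗ split ⟩
    sum f                                                  ∎
    where
    open ≡-Reasoning
    split : ∀ i → ind (j ≟ i) * f i + except j f i ≡ f i
    split i with j ≟ i
    ... | yes _ = trans (+-identityʳ _) (+-identityʳ _)
    ... | no _  = refl

  record Finite (A : Set) : Set where
    field
      size        : ℕ
      enumeration : A ↔ Fin size

    open Inverse enumeration public using (to; from; strictlyInverseˡ; strictlyInverseʳ)

    to-injective : ∀ {x y} → to x ≡ to y → x ≡ y
    to-injective {x} {y} eq = trans (sym (strictlyInverseʳ x)) (trans (cong from eq) (strictlyInverseʳ y))

  open Finite {{...}} public using (size)

  instance
    finite-Fin : ∀ {n} → Finite (Fin n)
    finite-Fin = record { enumeration = ↔-id _ }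

    finite-× : ∀ {A B : Set} → {{Finite A}} → {{Finite B}} → Finite (A × B)
    finite-× {{FA}} {{FB}} = record
      { enumeration = ↔-sym *↔× ↔-∘ (Finite.enumeration FA ×-↔ Finite.enumeration FB) }

  opaque
    ∑ : ∀ {A : Set} {{FA : Finite A}} → (A → ℕ) → ℕ
    ∑ {{FA}} f = sum (f ∘ Finite.from FA)

  count : ∀ {A : Set} {{FA : Finite A}} {P : Pred A 0ℓ} → Decidable P → ℕ
  count P? = ∑ λ x → ind (P? x)

  module _ {A : Set} {{FA : Finite A}} where
    private module A = Finite FA

    opaque
      unfolding ∑

      ∑-mono : ∀ {f g : A → ℕ} → (∀ x → f x ≤ g x) → ∑ f ≤ ∑ g
      ∑-mono f≤g = sum-mono (f≤g ∘ A.from)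

      ∑-cong : ∀ {f g : A → ℕ} → (∀ x → f x ≡ g x) → ∑ f ≡ ∑ g
      ∑-cong f≡g = sum-cong-≗ (f≡g ∘ A.from)

      ∑-+ : ∀ (f g : A → ℕ) → ∑ (λ x → f x + g x) ≡ ∑ f + ∑ g
      ∑-+ f g = ∑-distrib-+ (f ∘ A.from) (g ∘ A.from)

      ∑-* : ∀ c (f : A → ℕ) → ∑ (λ x → c * f x) ≡ c * ∑ f
      ∑-* c f = sum-*ˡ c (f ∘ A.from)

      ∑-const : ∀ c → ∑ {A} (λ _ → c) ≡ size {A} * c
      ∑-const c = sum-const A.size

      ∑-unique : ∀ {xs} → Unique xs → (f : A → ℕ) → ℕ-sum (List.map f xs) ≤ ∑ f
      ∑-unique {xs} xs! f = subst (λ s → s ≤ ∑ f) (cong ℕ-sum (mapped xs)) (go xs! (f ∘ A.from))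
        where
        mapped : ∀ ys → List.map (f ∘ A.from ∘ A.to) ys ≡ List.map f ys
        mapped []       = refl
        mapped (y ∷ ys) = cong₂ _∷_ (cong f (A.strictlyInverseʳ y)) (mapped ys)

        go : ∀ {ys} → Unique ys → (g : Fin A.size → ℕ) → ℕ-sum (List.map (g ∘ A.to) ys) ≤ sum g
        go []                 g = z≤n
        go {y ∷ ys} (y∉ ∷ ys!) g =
          subst (g (A.to y) + ℕ-sum (List.map (g ∘ A.to) ys) ≤_) (sum-except g (A.to y))
            (+-monoʳ-≤ (g (A.to y))
              (subst (_≤ sum (except (A.to y) g)) (cong ℕ-sum (avoid y∉)) (go ys! (except (A.to y) g))))
          where
          avoid : ∀ {zs} → All (y ≢_) zs →
                  List.map (except (A.to y) g ∘ A.to) zs ≡ List.map (g ∘ A.to) zs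
          avoid []           = refl
          avoid (y≢z ∷ rest) = cong₂ _∷_ (except-≢ g (y≢z ∘ A.to-injective)) (avoid rest)

    count-mono : ∀ {P Q : Pred A 0ℓ} (P? : Decidable P) (Q? : Decidable Q) →
                 (∀ {x} → P x → Q x) → count P? ≤ count Q?
    count-mono P? Q? P⊆Q = ∑-mono λ x → ind-mono (P? x) (Q? x) P⊆Q

    count-⊎ : ∀ {P Q R : Pred A 0ℓ} (P? : Decidable P) (Q? : Decidable Q) (R? : Decidable R) →
              (∀ {x} → P x → Q x ⊎ R x) → count P? ≤ count Q? + count R?
    count-⊎ P? Q? R? split = ≤-trans (∑-mono pointwise)
        (≤-reflexive (∑-+ (λ x → ind (Q? x)) (λ x → ind (R? x))))
      where
      pointwise : ∀ x → ind (P? x) ≤ ind (Q? x) + ind (R? x)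
      pointwise x with P? x
      ... | no _  = z≤n
      ... | yes p with Q? x | R? x
      ...   | yes _ | _     = s≤s z≤n
      ...   | no _  | yes _ = ≤-refl
      ...   | no ¬q | no ¬r with split p
      ...     | inj₁ q = contradiction q ¬q
      ...     | inj₂ r = contradiction r ¬r

    count-disjoint : ∀ {P Q R : Pred A 0ℓ} (P? : Decidable P) (Q? : Decidable Q) (R? : Decidable R) →
                     (∀ {x} → P x → R x) → (∀ {x} → Q x → R x) → (∀ {x} → P x → ¬ Q x) →
                     count P? + count Q? ≤ count R?
    count-disjoint P? Q? R? P⊆R Q⊆R P∩Q =
        ≤-trans (≤-reflexive (sym (∑-+ (λ x → ind (P? x)) (λ x → ind (Q? x))))) (∑-mono pointwise)
      where
      pointwise : ∀ x → ind (P? x) + ind (Q? x) ≤ ind (R? x)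
      pointwise x with P? x | Q? x
      ... | no _  | q?    = ind-mono q? (R? x) Q⊆R
      ... | yes p | yes q = contradiction q (P∩Q p)
      ... | yes p | no _  = ind-mono (yes p) (R? x) P⊆R

    count-inclusion-exclusion :
      ∀ {P Q U V : Pred A 0ℓ} (P? : Decidable P) (Q? : Decidable Q) (U? : Decidable U) (V? : Decidable V) →
      (∀ {x} → P x → U x) → (∀ {x} → Q x → U x) → (∀ {x} → P x → Q x → V x) →
      count P? + count Q? ≤ count U? + count V?
    count-inclusion-exclusion P? Q? U? V? P⊆U Q⊆U P∩Q⊆V = ≤-trans
      (≤-reflexive (sym (∑-+ (λ x → ind (P? x)) (λ x → ind (Q? x)))))
      (≤-trans (∑-mono pointwise) (≤-reflexive (∑-+ (λ x → ind (U? x)) (λ x → ind (V? x)))))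
      where
      pointwise : ∀ x → ind (P? x) + ind (Q? x) ≤ ind (U? x) + ind (V? x)
      pointwise x with P? x | Q? x
      ... | no _  | q?    = ≤-trans (ind-mono q? (U? x) Q⊆U) (m≤m+n _ _)
      ... | yes p | no _  = ≤-trans (ind-mono (yes p) (U? x) P⊆U) (m≤m+n _ _)
      ... | yes p | yes q = +-mono-≤ (ind-mono (yes p) (U? x) P⊆U) (ind-mono (yes q) (V? x) (P∩Q⊆V p))

    count-∁ : ∀ {P : Pred A 0ℓ} (P? : Decidable P) → count P? + count (λ x → ¬? (P? x)) ≡ size {A}
    count-∁ P? = trans (sym (∑-+ (λ x → ind (P? x)) (λ x → ind (¬? (P? x)))))
        (trans (∑-cong pointwise) (trans (∑-const 1) (*-identityʳ _)))
      where
      pointwise : ∀ x → ind (P? x) + ind (¬? (P? x)) ≡ 1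
      pointwise x with P? x
      ... | yes _ = refl
      ... | no _  = refl

    count≤size : ∀ {P : Pred A 0ℓ} (P? : Decidable P) → count P? ≤ size {A}
    count≤size P? = subst (count P? ≤_) (count-∁ P?) (m≤m+n _ _)

    opaque
      unfolding ∑

      count-singleton : ∀ {P : Pred A 0ℓ} (P? : Decidable P) → (∀ {x y} → P x → P y → x ≡ y) → count P? ≤ 1
      count-singleton P? unique = go (P? ∘ A.from) λ p q →
          trans (sym (A.strictlyInverseˡ _)) (trans (cong A.to (unique p q)) (A.strictlyInverseˡ _))
        where
        none : ∀ {n} {Q : Pred (Fin n) 0ℓ} (Q? : Decidable Q) → (∀ {i} → ¬ Q i) → sum (λ i → ind (Q? i)) ≤ 0
        none {zero}  Q? ¬q = z≤n
        none {suc n} Q? ¬q with Q? zero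
        ... | yes q = contradiction q ¬q
        ... | no _  = none (Q? ∘ suc) ¬q

        go : ∀ {n} {Q : Pred (Fin n) 0ℓ} (Q? : Decidable Q) → (∀ {i j} → Q i → Q j → i ≡ j) →
            sum (λ i → ind (Q? i)) ≤ 1
        go {zero}  Q? !q = z≤n
        go {suc n} Q? !q with Q? zero
        ... | yes q = s≤s (none (Q? ∘ suc) λ q′ → contradiction (!q q q′) λ ())
        ... | no _  = go (Q? ∘ suc) λ q q′ → suc-injective (!q q q′)

    opaque
      unfolding ∑

      ∑-fibres : ∀ {k} (h : A → Fin k) (f : A → ℕ) → ∑ (λ j → ∑ λ x → ind (h x ≟ j) * f x) ≡ ∑ f
      ∑-fibres {k} h f = trans (∑-comm {k} {A.size} (λ j i → ind (h (A.from i) ≟ j) * f (A.from i)))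
        (sum-cong-≗ λ i → sum-δ (λ _ → f (A.from i)) (h (A.from i)))

      -- Summation over the fibres of `h`: a fibre has at most one element in `P`, and none unless
      -- it lies over an element of `Q`.
      count-injective : ∀ {B : Set} {{FB : Finite B}} {P : Pred A 0ℓ} {Q : Pred B 0ℓ}
                        (P? : Decidable P) (Q? : Decidable Q)
                        (h : A → B) → (∀ {x} → P x → Q (h x)) → (∀ {x y} → P x → P y → h x ≡ h y → x ≡ y) →
                        count P? ≤ count Q?
      count-injective {{FB}} {P} {Q} P? Q? h P→Q inj =
        subst (_≤ count Q?) (∑-fibres (B.to ∘ h) (λ x → ind (P? x))) (sum-mono fibre)
        where
        module B = Finite FB
        fibre : ∀ j → ∑ (λ x → ind (B.to (h x) ≟ j) * ind (P? x)) ≤ ind (Q? (B.from j))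
        fibre j with Q? (B.from j)
        ... | yes _ = ≤-trans (∑-mono λ x → product (B.to (h x) ≟ j) (P? x))
            (count-singleton (λ x → (B.to (h x) ≟ j) ×-dec P? x)
                        λ (eq , p) (eq′ , p′) → inj p p′ (B.to-injective (trans eq (sym eq′))))
          where
          product : ∀ {X Y : Set} (X? : Dec X) (Y? : Dec Y) → ind X? * ind Y? ≤ ind (X? ×-dec Y?)
          product (yes _) (yes _) = ≤-refl
          product (yes _) (no _)  = z≤n
          product (no _)  _       = z≤n
        ... | no ¬q = ≤-trans (∑-mono zeroes) (≤-reflexive (trans (∑-const 0) (*-zeroʳ (size {A}))))
          where
          zeroes : ∀ x → ind (B.to (h x) ≟ j) * ind (P? x) ≤ 0
          zeroes x with B.to (h x) ≟ j | P? x
          ... | no _   | _     = z≤n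
          ... | yes _  | no _  = z≤n
          ... | yes eq | yes p = contradiction
              (subst Q (trans (sym (B.strictlyInverseʳ (h x))) (cong B.from eq)) (P→Q p)) ¬q

    count-none : ∀ {P : Pred A 0ℓ} (P? : Decidable P) → (∀ {x} → ¬ P x) → count P? ≤ 0
    count-none P? ¬p = ≤-trans (∑-mono pointwise) (≤-reflexive (trans (∑-const 0) (*-zeroʳ (size {A}))))
      where
      pointwise : ∀ x → ind (P? x) ≤ 0
      pointwise x with P? x
      ... | yes p = contradiction p ¬p
      ... | no _  = z≤n

    any-finite? : ∀ {P : Pred A 0ℓ} → Decidable P → Dec (∃ P)
    any-finite? {P} P? with any? (P? ∘ A.from)
    ... | yes (i , p) = yes (A.from i , p)
    ... | no ¬p       = no λ (x , p) → ¬p (A.to x , subst P (sym (A.strictlyInverseʳ x)) p)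

    count-injective-on : ∀ {B : Set} {{FB : Finite B}} {P : Pred A 0ℓ} {Q : Pred B 0ℓ}
                         (P? : Decidable P) (Q? : Decidable Q)
                         (h : ∀ {x} → P x → B) → (∀ {x} (p : P x) → Q (h p)) →
                         (∀ {x y} (p : P x) (q : P y) → h p ≡ h q → x ≡ y) →
                         count P? ≤ count Q?
    count-injective-on {B} {P = P} {Q} P? Q? h P→Q inj with any-finite? P?
    ... | no none       = ≤-trans (count-none P? λ p → none (_ , p)) z≤n
    ... | yes (x₀ , p₀) = count-injective P? Q? h′ maps h′-injective
      where
      h′ : A → B
      h′ x with P? x
      ... | yes p = h p
      -- An arbitrary value outside `P`, where nothing is counted.
      ... | no _  = h p₀
      maps : ∀ {x} → P x → Q (h′ x)
      maps {x} p with P? x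
      ... | yes p′ = P→Q p′
      ... | no ¬p  = contradiction p ¬p
      h′-injective : ∀ {x y} → P x → P y → h′ x ≡ h′ y → x ≡ y
      h′-injective {x} {y} p q eq with P? x | P? y
      ... | yes p′ | yes q′ = inj p′ q′ eq
      ... | no ¬p  | _      = contradiction p ¬p
      ... | _      | no ¬q  = contradiction q ¬q

  module _ {A B : Set} {{FA : Finite A}} {{FB : Finite B}} where

    count-image : ∀ {P : Pred B 0ℓ} (P? : Decidable P) (h : A → B) → (∀ {x y} → h x ≡ h y → x ≡ y) →
                  count (λ x → P? (h x)) ≤ count P?
    count-image P? h inj = count-injective (λ x → P? (h x)) P? h id λ _ _ → inj

  -- The reverse inequality is count-image, applied here to the complement.
  count-permute : ∀ {A : Set} {{FA : Finite A}} {P : Pred A 0ℓ} (P? : Decidable P) (h : A → A) →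
                  (∀ {x y} → h x ≡ h y → x ≡ y) → count P? ≤ count (λ x → P? (h x))
  count-permute {A} P? h inj = +-cancelʳ-≤ (count (λ x → ¬? (P? x))) _ _ (begin
    count P? + count (λ x → ¬? (P? x))              ≡⟨ count-∁ P? ⟩
    size {A}                                        ≡⟨ count-∁ (λ x → P? (h x)) ⟨
    count (λ x → P? (h x)) + count (λ x → ¬? (P? (h x)))
      ≤⟨ +-monoʳ-≤ (count (λ x → P? (h x))) (count-image (λ x → ¬? (P? x)) h inj) ⟩
    count (λ x → P? (h x)) + count (λ x → ¬? (P? x)) ∎)
    where open ≤-Reasoning

  count≤length : ∀ {n} {P : Pred (Fin n) 0ℓ} (P? : Decidable P) xs → (∀ {x} → P x → x ∈ᴸ xs) →
      count P? ≤ List.length xs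
  count≤length P? []       P⊆ = count-none P? λ p → contradiction (P⊆ p) λ ()
  count≤length {P = P} P? (x ∷ xs) P⊆ = ≤-trans
    (count-⊎ P? (_≟ x) (λ y → P? y ×-dec ¬? (y ≟ x)) split)
    (+-mono-≤ (count-singleton (_≟ x) λ { refl refl → refl })
              (count≤length (λ y → P? y ×-dec ¬? (y ≟ x)) xs λ (p , ≢x) → remaining (P⊆ p) ≢x))
    where
    split : ∀ {y} → P y → y ≡ x ⊎ (P y × y ≢ x)
    split {y} p with y ≟ x
    ... | yes eq = inj₁ eq
    ... | no ≢x  = inj₂ (p , ≢x)
    remaining : ∀ {y} → y ∈ᴸ x ∷ xs → y ≢ x → y ∈ᴸ xs
    remaining (here eq)   ≢x = contradiction eq ≢x
    remaining (there y∈) _ = y∈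

  count-∃ : ∀ {A : Set} {{FA : Finite A}} {k b} {Q : Fin k → Pred A 0ℓ} (Q? : ∀ i → Decidable (Q i)) →
            (∀ i → count (Q? i) ≤ b) → count (λ x → any? λ i → Q? i x) ≤ k * b
  count-∃ {k = zero}  Q? bound = count-none (λ x → any? λ i → Q? i x) λ ()
  count-∃ {k = suc k} Q? bound = ≤-trans
    (count-⊎ (λ x → any? λ i → Q? i x) (Q? zero) (λ x → any? λ i → Q? (suc i) x)
      λ { (zero , q) → inj₁ q ; (suc i , q) → inj₂ (i , q) })
    (+-mono-≤ (bound zero) (count-∃ (Q? ∘ suc) (bound ∘ suc)))

  ⟨_⟩ : ∀ {n} {P : Pred (Fin n) 0ℓ} → Decidable P → Subset n
  ⟨ P? ⟩ = tabulate λ i → does (P? i)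

  ∈⟨⟩⁺ : ∀ {n} {P : Pred (Fin n) 0ℓ} (P? : Decidable P) {i} → P i → i ∈ ⟨ P? ⟩
  ∈⟨⟩⁺ P? {i} p = lookup⇒[]= i _ (trans (lookup∘tabulate _ i) (dec-true (P? i) p))

  ∈⟨⟩⁻ : ∀ {n} {P : Pred (Fin n) 0ℓ} (P? : Decidable P) {i} → i ∈ ⟨ P? ⟩ → P i
  ∈⟨⟩⁻ P? {i} i∈ with P? i | trans (sym (lookup∘tabulate (λ i → does (P? i)) i)) ([]=⇒lookup i∈)
  ... | yes p | _ = p

  opaque
    unfolding ∑

    ∣⟨⟩∣ : ∀ {n} {P : Pred (Fin n) 0ℓ} (P? : Decidable P) → ∣ ⟨ P? ⟩ ∣ ≡ count P?
    ∣⟨⟩∣ {zero}  P? = refl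
    ∣⟨⟩∣ {suc n} P? with P? zero
    ... | yes _ = cong suc (∣⟨⟩∣ (P? ∘ suc))
    ... | no _  = ∣⟨⟩∣ (P? ∘ suc)

  -- Cycles of permutations

  ind-yes : ∀ {P : Set} (P? : Dec P) → P → ind P? ≡ 1
  ind-yes (yes _) _ = refl
  ind-yes (no ¬p) p = contradiction p ¬p

  least : ∀ {P : Pred ℕ 0ℓ} → Decidable P → ∀ b → P b → ∃[ m ] (P m × ∀ k → k < m → ¬ P k)
  least P? zero    p = 0 , p , λ _ ()
  least P? (suc b) p with P? 0
  ... | yes p₀ = 0 , p₀ , λ _ ()
  ... | no ¬p₀ with least (P? ∘ suc) b p
  ...   | m , pₘ , below = suc m , pₘ , λ { zero _ → ¬p₀ ; (suc k) k<m → below k (s≤s⁻¹ k<m) }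

  -- If `y` were missed, punching it out would inject `Fin (suc n)` into `Fin n`.
  injective⇒surjective : ∀ {n} {h : Fin n → Fin n} → Injective _≡_ _≡_ h → ∀ y → ∃[ x ] h x ≡ y
  injective⇒surjective {suc n} {h} inj y with any? (λ x → h x ≟ y)
  ... | yes hit  = hit
  ... | no  miss = contradiction (injective⇒≤ {f = λ x → punchOut (avoids x)} punched) 1+n≰n
    where
    avoids : ∀ x → y ≢ h x
    avoids x eq = miss (x , sym eq)
    punched : Injective _≡_ _≡_ (λ x → punchOut (avoids x))
    punched {a} {b} eq = inj (punchOut-injective (avoids a) (avoids b) eq)

  -- A section of `h` is injective, hence surjective, and so it is a two-sided inverse of `h`.
  surjective⇒injective : ∀ {n} {h : Fin n → Fin n} → (∀ y → ∃[ x ] h x ≡ y) → Injective _≡_ _≡_ h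
  surjective⇒injective {n} {h} sur {a} {b} ha≡hb =
    trans (sym (hit a)) (trans (cong section (trans (sym (section-of a)) (trans ha≡hb (section-of b))))
        (hit b))
    where
    section : Fin n → Fin n
    section y = proj₁ (sur y)
    section-injective : Injective _≡_ _≡_ section
    section-injective {x} {y} eq = trans (sym (proj₂ (sur x))) (trans (cong h eq) (proj₂ (sur y)))
    preimage : Fin n → Fin n
    preimage y = proj₁ (injective⇒surjective section-injective y)
    hit : ∀ y → section (preimage y) ≡ y
    hit y = proj₂ (injective⇒surjective section-injective y)
    section-of : ∀ y → h y ≡ preimage y
    section-of y = trans (cong h (sym (hit y))) (proj₂ (sur (preimage y)))

  module Period {A : Set} {{FA : Finite A}} (_≈?_ : DecidableEquality A)
                (g : A → A) (g-injective : Injective _≡_ _≡_ g) (x : A) where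

    private
      cancel : ∀ i {j} → fold x g (i + j) ≡ fold x g i → fold x g j ≡ x
      cancel zero    eq = eq
      cancel (suc i) eq = cancel i (g-injective eq)

      differ : ∀ {i j} → i < j → fold x g i ≡ fold x g j → fold x g (j ∸ i) ≡ x
      differ {i} i<j eq = cancel i (trans (cong (fold x g) (m+[n∸m]≡n (<⇒≤ i<j))) (sym eq))

      returns : ∃[ k ] fold x g (suc k) ≡ x
      returns with pigeonhole {m = size {A}} ≤-refl (λ i → Finite.to FA (fold x g (toℕ i)))
      ... | i , j , i<j , eq with toℕ j ∸ toℕ i in d | differ i<j (Finite.to-injective FA eq)
      ...   | zero  | _  = contradiction (m∸n≡0⇒m≤n d) (<⇒≱ i<j)
      ...   | suc k | eq′ = k , eq′

      smallest : ∃[ m ] (fold x g (suc m) ≡ x × ∀ k → k < m → fold x g (suc k) ≢ x)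
      smallest = least (λ k → fold x g (suc k) ≈? x) (proj₁ returns) (proj₂ returns)

    opaque
      period : ℕ
      period = suc (proj₁ smallest)

      fold-period : fold x g period ≡ x
      fold-period = proj₁ (proj₂ smallest)

      fold-injective : ∀ {i j} → i < period → j < period → fold x g i ≡ fold x g j → i ≡ j
      fold-injective {i} {j} i< j< eq = by-cases (<-cmp i j)
        where
        absurd : ∀ {i j} → i < j → j < period → fold x g i ≢ fold x g j
        absurd {i} {j} i<j j< eq with j ∸ i in d | differ i<j eq
        ... | zero  | _   = <⇒≱ i<j (m∸n≡0⇒m≤n d)
        ... | suc k | eq′ =
          proj₂ (proj₂ smallest) k (s≤s⁻¹ (≤-<-trans (subst (_≤ j) d (m∸n≤m j i)) j<)) eq′
        by-cases : Tri (i < j) (i ≡ j) (j < i) → i ≡ j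
        by-cases (tri< i<j _ _) = contradiction eq (absurd i<j j<)
        by-cases (tri≈ _ i≡j _) = i≡j
        by-cases (tri> _ _ j<i) = contradiction (sym eq) (absurd j<i i<)

      fold-reduce : ∀ k → ∃[ i ] (i < period × fold x g i ≡ fold x g k)
      fold-reduce zero = 0 , z<s , refl
      fold-reduce (suc k) with fold-reduce k
      ... | i , i< , eq with suc i <? period
      ...   | yes si< = suc i , si< , cong g eq
      ...   | no si≮ = 0 , z<s , trans (sym fold-period) (trans (cong (fold x g) (≤-antisym (≮⇒≥ si≮) i<))
          (cong g eq))

  module _ {A : Set} {{_ : Finite A}} (_≈?_ : DecidableEquality A)
           {Dart : Pred A 0ℓ} (dart? : Decidable Dart)
           (π : A → A) (π-injective : Injective _≡_ _≡_ π) (π-dart : ∀ {d} → Dart d → Dart (π d)) where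

    Long : Pred A 0ℓ
    Long d = Dart d × π (π (π (π d))) ≢ d

    long? : Decidable Long
    long? d = dart? d ×-dec ¬? (π (π (π (π d))) ≈? d)

    -- A dart weighs 5 if the length of its cycle divides 4, and 4 otherwise, so
    -- that a cycle of at least 4 darts weighs at least 20.
    count-cycles : ∀ {k} (c : A → Fin k) → (∀ {d} → Dart d → c (π d) ≡ c d) →
      {X : Pred (Fin k) 0ℓ} (X? : Decidable X) →
      (∀ i → ¬ X i → ∃[ d ] (Dart d × c d ≡ i × π d ≢ d × π (π d) ≢ d × π (π (π d)) ≢ d)) →
      k * 20 + count long? ≤ 5 * count dart? + 20 * count X?
    count-cycles {k} c c-π {X} X? rep = begin
      k * 20 + count long?
        ≤⟨ +-monoˡ-≤ (count long?) (≤-trans (≤-reflexive (sym (∑-const {Fin k} 20))) (∑-mono fibre)) ⟩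
      ∑ (λ i → F i + 20 * ind (X? i)) + count long?
        ≡⟨ cong (_+ count long?) (trans (∑-+ F (λ i → 20 * ind (X? i)))
            (cong₂ _+_ (∑-fibres c weight) (∑-* 20 (λ i → ind (X? i))))) ⟩
      (∑ weight + 20 * count X?) + count long?
        ≡⟨ rearrange (∑ weight) _ (count long?) ⟩
      (∑ weight + count long?) + 20 * count X?
        ≡⟨ cong (_+ 20 * count X?) (trans (sym (∑-+ weight (λ d → ind (long? d))))
            (trans (∑-cong five) (∑-* 5 (λ d → ind (dart? d))))) ⟩
      5 * count dart? + 20 * count X? ∎
      where
      open ≤-Reasoning
      weight : A → ℕ
      weight d = 4 * ind (dart? d) + ind (dart? d ×-dec (π (π (π (π d))) ≈? d))

      F : Fin k → ℕ
      F i = ∑ λ d → ind (c d ≟ i) * weight d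

      rearrange : ∀ a b e → (a + b) + e ≡ (a + e) + b
      rearrange = solve-∀

      -- A long dart falls short of weight 5 by one, which is how the long darts enter the bound.
      five : ∀ d → weight d + ind (long? d) ≡ 5 * ind (dart? d)
      five d with dart? d | π (π (π (π d))) ≈? d
      ... | yes _ | yes _ = refl
      ... | yes _ | no _  = refl
      ... | no _  | _     = refl

      summand≥4 : ∀ {d i} → Dart d → c d ≡ i → 4 ≤ ind (c d ≟ i) * weight d
      summand≥4 {d} {i} p refl rewrite ind-yes (c d ≟ i) refl | ind-yes (dart? d) p =
          s≤s (s≤s (s≤s (s≤s z≤n)))

      summand≥5 : ∀ {d i} → Dart d → c d ≡ i → π (π (π (π d))) ≡ d → 5 ≤ ind (c d ≟ i) * weight d
      summand≥5 {d} {i} p refl eq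
        rewrite ind-yes (c d ≟ i) refl
              | ind-yes (dart? d ×-dec (π (π (π (π d))) ≈? d)) (p , eq)
              | ind-yes (dart? d) p =
        ≤-refl

      fibre : ∀ i → 20 ≤ F i + 20 * ind (X? i)
      fibre i with X? i
      ... | yes _ = m≤n+m 20 (F i)
      ... | no ¬x with rep i ¬x
      ...   | d , p , cd , 1≢ , 2≢ , 3≢ = ≤-trans enough (m≤m+n (F i) _)
        where
        f : A → ℕ
        f d = ind (c d ≟ i) * weight d
        p₁ = π-dart p
        p₂ = π-dart p₁
        p₃ = π-dart p₂
        p₄ = π-dart p₃
        c₁ = trans (c-π p) cd
        c₂ = trans (c-π p₁) c₁
        c₃ = trans (c-π p₂) c₂
        c₄ = trans (c-π p₃) c₃
        -- Either four distinct darts of weight 5, or five distinct darts of weight at least 4.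
        enough : 20 ≤ F i
        enough with π (π (π (π d))) ≈? d
        ... | yes eq = ≤-trans
          (+-mono-≤ (summand≥5 p cd eq)
              (+-mono-≤ (summand≥5 p₁ c₁ (cong π eq)) (+-mono-≤ (summand≥5 p₂ c₂ (cong (π ∘ π) eq))
            (+-mono-≤ (summand≥5 p₃ c₃ (cong (π ∘ π ∘ π) eq)) z≤n))))
          (∑-unique {xs = d ∷ π d ∷ π (π d) ∷ π (π (π d)) ∷ []}
            ((≢-sym 1≢ ∷ ≢-sym 2≢ ∷ ≢-sym 3≢ ∷ []) ∷
             (≢-sym 1≢ ∘ π-injective ∷ ≢-sym 2≢ ∘ π-injective ∷ []) ∷
             (≢-sym 1≢ ∘ π-injective ∘ π-injective ∷ []) ∷ [] ∷ []) f)
        ... | no 4≢ = ≤-trans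
          (+-mono-≤ (summand≥4 p cd) (+-mono-≤ (summand≥4 p₁ c₁) (+-mono-≤ (summand≥4 p₂ c₂)
            (+-mono-≤ (summand≥4 p₃ c₃) (+-mono-≤ (summand≥4 p₄ c₄) z≤n)))))
          (∑-unique {xs = d ∷ π d ∷ π (π d) ∷ π (π (π d)) ∷ π (π (π (π d))) ∷ []}
            ((≢-sym 1≢ ∷ ≢-sym 2≢ ∷ ≢-sym 3≢ ∷ ≢-sym 4≢ ∷ []) ∷
             (≢-sym 1≢ ∘ π-injective ∷ ≢-sym 2≢ ∘ π-injective ∷ ≢-sym 3≢ ∘ π-injective ∷ []) ∷
             (≢-sym 1≢ ∘ π-injective ∘ π-injective ∷ ≢-sym 2≢ ∘ π-injective ∘ π-injective ∷ []) ∷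
             (≢-sym 1≢ ∘ π-injective ∘ π-injective ∘ π-injective ∷ []) ∷ [] ∷ []) f)

  -- Rotation systems

  class-injective : ∀ {S : Setoid 0ℓ 0ℓ} {k} (c : HasClasses S k) {x y} →
                    Inverse.to c x ≡ Inverse.to c y → Setoid._≈_ S x y
  class-injective {S} c {x} {y} eq =
    S.trans (S.sym (Inverse.strictlyInverseʳ c x))
        (S.trans (Inverse.from-cong c eq) (Inverse.strictlyInverseʳ c y))
    where module S = Setoid S

  module _ {n} (G : Graph n) where
    open Graph G

    deg : Fin n → ℕ
    deg v = count (adj? v)

    Low : Pred (Fin n) 0ℓ
    Low v = deg v ≤ 3

    low? : Decidable Low
    low? v = deg v ≤? 3

    loopless : ∀ {u} → ¬ Adj u u
    loopless = adj-irrefl refl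

    deg≤length : ∀ {u} xs → (∀ {w} → Adj u w → w ∈ᴸ xs) → deg u ≤ List.length xs
    deg≤length {u} = count≤length (adj? u)

  module Embedded {n} (G : Graph n) (R : Rotation G) where
    open Graph G
    open Rotation R

    -- Pairs without a proof of adjacency form a finite type with decidable equality; the pairs that
    -- are no darts are excluded by `IsDart` where it matters.
    D : Set
    D = Fin n × Fin n

    _≟ᴰ_ : DecidableEquality D
    _≟ᴰ_ = ≡-dec _≟_ _≟_

    IsDart : Pred D 0ℓ
    IsDart (u , w) = Adj u w

    dart? : Decidable IsDart
    dart? (u , w) = adj? u w

    -- Extended by the identity to the pairs which are not adjacent, in order to
    -- be a permutation.
    next′ : Fin n → Fin n → Fin n
    next′ u w = if does (adj? u w) then next u w else w

    next′≡next : ∀ {u w} → Adj u w → next′ u w ≡ next u w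
    next′≡next {u} {w} a with adj? u w
    ... | yes _ = refl
    ... | no ¬a = contradiction a ¬a

    next′-adj : ∀ {u w} → Adj u w → Adj u (next′ u w)
    next′-adj {u} {w} a = subst (Adj u) (sym (next′≡next a)) (next-adj a)

    -- By `cyclic`, the neighbours of `u` form a single cycle, so a property closed under `next′`
    -- spreads from one of them to all.
    around-induct : ∀ {u} (Q : Pred (Fin n) 0ℓ) → (∀ {x} → Adj u x → Q x → Q (next′ u x)) →
                    ∀ {v} → Adj u v → Q v → ∀ {w} → Adj u w → Q w
    around-induct {u} Q step a q a′ = go a q (cyclic a a′)
      where
      go : ∀ {v w} → Adj u v → Q v → Star (λ x y → next u x ≡ y) v w → Q w
      go a q ε          = q
      go a q (refl ◅ s) = go (next-adj a) (subst Q (next′≡next a) (step a q)) s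

    next′-surjective : ∀ u w → ∃[ x ] next′ u x ≡ w
    next′-surjective u w with adj? u w in eq
    ... | no ¬a = w , fixed
      where
      fixed : next′ u w ≡ w
      fixed rewrite eq = refl
    -- The walk starts after `w`, at a vertex with the preimage `w`, and goes round the cycle until
    -- it is back at `w`.
    ... | yes a = around-induct (λ x → ∃[ y ] next′ u y ≡ x) (λ {x} _ _ → x , refl) (next′-adj a) (w , refl) a

    next′-injective : ∀ u → Injective _≡_ _≡_ (next′ u)
    next′-injective u = surjective⇒injective (next′-surjective u)

    -- The permutations of a combinatorial map: on the darts, the cycles of `rot`, `rev` and `φ` are
    -- the vertices, the edges and the faces.
    rot rev φ : D → D
    rot (u , w) = u , next′ u w
    rev         = swap
    φ           = rot ∘ rev

    rot-injective : Injective _≡_ _≡_ rot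
    rot-injective {u , w} {u′ , w′} eq with ,-injectiveˡ eq
    ... | refl = cong (u ,_) (next′-injective u (,-injectiveʳ eq))

    rev-injective : Injective _≡_ _≡_ rev
    rev-injective {u , w} {u′ , w′} eq = cong rev eq

    φ-injective : Injective _≡_ _≡_ φ
    φ-injective = rev-injective ∘ rot-injective

    rot-dart : ∀ {d} → IsDart d → IsDart (rot d)
    rot-dart = next′-adj

    rev-dart : ∀ {d} → IsDart d → IsDart (rev d)
    rev-dart = adj-sym

    φ-dart : ∀ {d} → IsDart d → IsDart (φ d)
    φ-dart = next′-adj ∘ adj-sym

    -- This and the next two lemmas: a list of neighbours that is closed under `next′` contains all
    -- of them.
    low₁ : ∀ {u v} → Adj u v → next′ u v ≡ v → Low G u
    low₁ {u} {v} a eq = ≤-trans (deg≤length G (v ∷ []) (around-induct (_∈ᴸ v ∷ []) step a (here refl)))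
        (s≤s z≤n)
      where
      step : ∀ {x} → Adj u x → x ∈ᴸ v ∷ [] → next′ u x ∈ᴸ v ∷ []
      step _ (here refl) = here eq

    low₂ : ∀ {u v} → Adj u v → next′ u (next′ u v) ≡ v → Low G u
    low₂ {u} {v} a eq = ≤-trans (deg≤length G vs (around-induct (_∈ᴸ vs) step a (here refl))) (s≤s (s≤s z≤n))
      where
      vs = v ∷ next′ u v ∷ []
      step : ∀ {x} → Adj u x → x ∈ᴸ vs → next′ u x ∈ᴸ vs
      step _ (here refl)         = there (here refl)
      step _ (there (here refl)) = here eq

    low₃ : ∀ {u v} → Adj u v → next′ u (next′ u (next′ u v)) ≡ v → Low G u
    low₃ {u} {v} a eq = deg≤length G vs (around-induct (_∈ᴸ vs) step a (here refl))
      where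
      vs = v ∷ next′ u v ∷ next′ u (next′ u v) ∷ []
      step : ∀ {x} → Adj u x → x ∈ᴸ vs → next′ u x ∈ᴸ vs
      step _ (here refl)                 = there (here refl)
      step _ (there (here refl))         = there (there (here refl))
      step _ (there (there (here refl))) = here eq

    four-neighbours : ∀ {u v} → Adj u v → rot (rot (rot (rot (u , v)))) ≡ (u , v) → ∀ {w} → Adj u w →
                      w ∈ᴸ v ∷ next′ u v ∷ next′ u (next′ u v) ∷ next′ u (next′ u (next′ u v)) ∷ []
    four-neighbours {u} {v} a eq = around-induct (_∈ᴸ vs) step a (here refl)
      where
      vs = v ∷ next′ u v ∷ next′ u (next′ u v) ∷ next′ u (next′ u (next′ u v)) ∷ []
      step : ∀ {x} → Adj u x → x ∈ᴸ vs → next′ u x ∈ᴸ vs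
      step _ (here refl)                         = there (here refl)
      step _ (there (here refl))                 = there (there (here refl))
      step _ (there (there (here refl)))         = there (there (there (here refl)))
      step _ (there (there (there (here refl)))) = here (,-injectiveʳ eq)

    -- Cycles of length 1 or 2 are not excluded: the grid uses only that four steps lead back to the
    -- dart, and its cells may coincide.
    NotFour NonQuad : Pred D 0ℓ
    NotFour = Long _≟ᴰ_ dart? rot rot-injective (λ {d} → rot-dart {d})
    NonQuad = Long _≟ᴰ_ dart? φ φ-injective (λ {d} → φ-dart {d})

    notFour? : Decidable NotFour
    notFour? = long? _≟ᴰ_ dart? rot rot-injective (λ {d} → rot-dart {d})

    nonQuad? : Decidable NonQuad
    nonQuad? = long? _≟ᴰ_ dart? φ φ-injective (λ {d} → φ-dart {d})

  -- Euler's formula and the number of irregular darts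

  module Sphere {n} (G : Graph n) (R : Rotation G) (S : Spherical G R) (v₀ : Fin n) where
    open Graph G
    open Rotation R
    open Embedded G R public
    open Spherical S public

    comp : Fin n → Fin C
    comp = Inverse.to components

    comp-adj : ∀ {u w} → Adj u w → comp u ≡ comp w
    comp-adj a = Inverse.to-cong components (return a)

    edge : ∀ {d} → IsDart d → Fin E
    edge a = Inverse.to edges (dart a)

    edge-injective : ∀ {d e} (a : IsDart d) (b : IsDart e) → edge a ≡ edge b → e ≡ d ⊎ e ≡ rev d
    edge-injective a b eq = go (class-injective edges eq)
      where
      ends : Dart G → D
      ends x = Dart.source x , Dart.target x
      go : ∀ {x y} → Setoid._≈_ (Edges G) x y → ends y ≡ ends x ⊎ ends y ≡ rev (ends x)
      go ε = inj₁ refl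
      go (fwd (reversal _ _) ◅ s) with go s
      ... | inj₁ eq = inj₂ eq
      ... | inj₂ eq = inj₁ eq
      go (bwd (reversal _ _) ◅ s) with go s
      ... | inj₁ eq = inj₂ eq
      ... | inj₂ eq = inj₁ eq

    base : Side G → Fin n
    base (along x)    = Dart.source x
    base (around u _) = u

    sideAt : Fin n → Side G
    sideAt u with any? (adj? u)
    ... | yes (w , a) = along (dart a)
    ... | no isolated = around u λ w a → isolated (w , a)

    faceOf : Side G → Fin F
    faceOf = Inverse.to faces

    sideOf : D → Side G
    sideOf (u , w) with adj? u w
    ... | yes a = along (dart a)
    -- An arbitrary side makes `face` total; only its values at darts matter.
    ... | no _  = sideAt v₀

    face : D → Fin F
    face d = faceOf (sideOf d)

    face-turn : ∀ {u v w} (p : Adj u v) (q : Adj v w) → next v u ≡ w →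
        faceOf (along (dart p)) ≡ faceOf (along (dart q))
    face-turn p q eq = Inverse.to-cong faces (return (turn p q eq))

    -- Two proofs of the same adjacency give sides of one face because both are followed by the same
    -- side.
    faceOf-along : ∀ {u w} (a : Adj u w) → face (u , w) ≡ faceOf (along (dart a))
    faceOf-along {u} {w} a with adj? u w
    ... | yes a′ = trans (face-turn a′ q refl) (sym (face-turn a q refl))
      where q = next-adj (adj-sym a)
    ... | no ¬a  = contradiction a ¬a

    face-φ : ∀ {d} → IsDart d → face (φ d) ≡ face d
    face-φ {u , w} a = trans (faceOf-along q)
        (sym (trans (faceOf-along a) (face-turn a q (sym (next′≡next (adj-sym a))))))
      where q = next′-adj (adj-sym a)

    -- A dart is determined by its edge and by whether its source is the smaller end.
    count-darts : count dart? ≤ E * 2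
    count-darts = ≤-trans
      (count-injective-on {Q = λ (_ : Fin E × Fin 2) → ⊤} dart? (λ _ → yes tt)
          (λ {d} a → edge a , orientation d) (λ _ → tt) inj)
      (count≤size {Fin E × Fin 2} (λ _ → yes tt))
      where
      bit : ∀ {P : Set} → Dec P → Fin 2
      bit (yes _) = suc zero
      bit (no _)  = zero
      orientation : D → Fin 2
      orientation (u , w) = bit (u <ᶠ? w)
      flip : ∀ {u w} → Adj u w → orientation (u , w) ≢ orientation (w , u)
      flip {u} {w} a = distinct (u <ᶠ? w) (w <ᶠ? u)
        where
        distinct : (p : Dec (u <ᶠ w)) (q : Dec (w <ᶠ u)) → bit p ≢ bit q
        distinct (yes u<w) (yes w<u) = contradiction w<u (<ᶠ-asym u<w)
        distinct (yes _)   (no _)    = λ ()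
        distinct (no _)    (yes _)   = λ ()
        distinct (no u≮w)  (no w≮u) with <ᶠ-cmp u w
        ... | tri< u<w _ _  = contradiction u<w u≮w
        ... | tri≈ _ refl _ = contradiction a (loopless G)
        ... | tri> _ _ w<u  = contradiction w<u w≮u
      inj : ∀ {d e} (a : IsDart d) (b : IsDart e) → (edge a , orientation d) ≡ (edge b , orientation e) →
          d ≡ e
      inj a b eq with edge-injective a b (,-injectiveˡ eq)
      ... | inj₁ refl = refl
      ... | inj₂ refl = contradiction (,-injectiveʳ eq) (flip a)

    -- Only the faces with such a side can have fewer than four sides.
    Lonely : Pred (Side G) 0ℓ
    Lonely (along (dart {u} {w} _)) = next′ u w ≡ w
    Lonely (around _ _)             = ⊤

    lonely? : Decidable Lonely
    lonely? (along (dart {u} {w} _)) = next′ u w ≟ w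
    lonely? (around _ _)             = yes tt

    lonely-low : ∀ s → Lonely s → Low G (base s)
    lonely-low (along (dart a)) eq = low₁ a eq
    lonely-low (around u iso)   _  = ≤-trans (count-none (adj? u) λ {w} → iso w) z≤n

    -- A lonely side is the only side at its base. Thus lonely faces can be charged to distinct
    -- vertices of low degree.
    lonely-injective : ∀ s t → Lonely s → Lonely t → base s ≡ base t → faceOf s ≡ faceOf t
    lonely-injective (along (dart {u} {w} a)) (along (dart {_} {x} b)) eq eq′ refl
      with around-induct (_≡ w) (λ { _ refl → eq }) a refl b
    ... | refl = trans (sym (faceOf-along a)) (faceOf-along b)
    lonely-injective (along (dart {u} {w} a)) (around _ iso) _ _ refl = contradiction a (iso w)
    lonely-injective (around _ iso) (along (dart {u} {w} a)) _ _ refl = contradiction a (iso w)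
    lonely-injective (around _ i) (around _ j) _ _ refl = Inverse.to-cong faces (return (stay i j))

    sideOn : Fin F → Side G
    sideOn = Inverse.from faces

    count-lonely : count (λ k → lonely? (sideOn k)) ≤ count (low? G)
    count-lonely = count-injective (λ k → lonely? (sideOn k)) (low? G) (base ∘ sideOn) (lonely-low _)
      λ {k} {l} p q eq → trans (sym (Inverse.strictlyInverseˡ faces k))
        (trans (lonely-injective (sideOn k) (sideOn l) p q eq) (Inverse.strictlyInverseˡ faces l))

    vertex-cycles : n * 20 + count notFour? ≤ 5 * count dart? + 20 * count (low? G)
    vertex-cycles = count-cycles _≟ᴰ_ dart? rot rot-injective (λ {d} → rot-dart {d}) proj₁ (λ _ → refl)
        (low? G) rep
      where
      rep : ∀ u → ¬ Low G u →
              ∃[ d ] (IsDart d × proj₁ d ≡ u × rot d ≢ d × rot (rot d) ≢ d × rot (rot (rot d)) ≢ d)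
      rep u high with any? (adj? u)
      ... | yes (w , a) = (u , w) , a , refl ,
        high ∘ low₁ a ∘ ,-injectiveʳ , high ∘ low₂ a ∘ ,-injectiveʳ , high ∘ low₃ a ∘ ,-injectiveʳ
      ... | no isolated = contradiction (≤-trans (count-none (adj? u) λ a → isolated (_ , a)) z≤n) high

    module _ (triangle-free : TriangleFree G) where

      face-cycles : F * 20 + count nonQuad? ≤ 5 * count dart? + 20 * count (low? G)
      face-cycles = ≤-trans
        (count-cycles _≟ᴰ_ dart? φ φ-injective (λ {d} → φ-dart {d}) face (λ {d} → face-φ {d})
            (λ k → lonely? (sideOn k)) rep)
        (+-monoʳ-≤ (5 * count dart?) (*-monoʳ-≤ 20 count-lonely))
        where
        rep : ∀ k → ¬ Lonely (sideOn k) →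
            ∃[ d ] (IsDart d × face d ≡ k × φ d ≢ d × φ (φ d) ≢ d × φ (φ (φ d)) ≢ d)
        rep k ¬lonely with sideOn k in eq
        ... | around _ _             = contradiction tt ¬lonely
        ... | along (dart {u} {w} a) = (u , w) , a ,
          trans (faceOf-along a) (trans (cong faceOf (sym eq)) (Inverse.strictlyInverseˡ faces k)) ,
          -- A facial walk closing after one step has a loop, after two steps an end of degree 1,
          -- and after three steps a triangle.
          (λ eq₁ → loopless G (subst (Adj u) (,-injectiveˡ eq₁) a)) ,
          (λ eq₂ → ¬lonely (trans (cong (λ x → next′ x w) (sym (,-injectiveˡ eq₂))) (,-injectiveʳ eq₂))) ,
          λ eq₃ → triangle-free a (φ-dart a) (subst (Adj _) (,-injectiveˡ eq₃) (φ-dart (φ-dart a)))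

      -- Vertices and faces together use 10 for each dart, hence 20 for each edge, and `E ≤ n + F`
      -- by Euler's formula. There remain the exceptional cycles, 20 for each low vertex and 20 for
      -- each lonely face.
      count-irregular : count notFour? + count nonQuad? ≤ 40 * count (low? G)
      count-irregular = +-cancelˡ-≤ (20 * (n + F)) _ _ (begin
        20 * (n + F) + (count notFour? + count nonQuad?)
          ≡⟨ regroup n F (count notFour?) (count nonQuad?) ⟩
        (n * 20 + count notFour?) + (F * 20 + count nonQuad?)
          ≤⟨ +-mono-≤ vertex-cycles face-cycles ⟩
        (5 * count dart? + 20 * count (low? G)) + (5 * count dart? + 20 * count (low? G))
          ≡⟨ regroup′ (count dart?) (count (low? G)) ⟩
        10 * count dart? + 40 * count (low? G)
          ≤⟨ +-monoˡ-≤ (40 * count (low? G)) (*-monoʳ-≤ 10 count-darts) ⟩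
        10 * (E * 2) + 40 * count (low? G)
          ≤⟨ +-monoˡ-≤ (40 * count (low? G))
              (≤-trans (≤-reflexive (regroup″ E))
              (*-monoʳ-≤ 20 (≤-trans (m≤m+n E (2 * C)) (≤-reflexive (sym euler))))) ⟩
        20 * (n + F) + 40 * count (low? G) ∎)
        where
        open ≤-Reasoning
        regroup : ∀ a b c d → 20 * (a + b) + (c + d) ≡ (a * 20 + c) + (b * 20 + d)
        regroup = solve-∀
        regroup′ : ∀ a b → (5 * a + 20 * b) + (5 * a + 20 * b) ≡ 10 * a + 40 * b
        regroup′ = solve-∀
        regroup″ : ∀ a → 10 * (a * 2) ≡ 20 * a
        regroup″ = solve-∀

  -- Fires in grids

  saves : ∀ {n} (G : Graph n) v σ → Process.Legal G ⁅ v ⁆ ∅ σ 2 →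
          ∀ {S : Pred (Fin n) 0ℓ} (S? : Decidable S) → (∀ t {w} → S w → w ∉ Process.burning G ⁅ v ⁆ ∅ σ t) →
          count S? ≤ sn 2 G v
  saves {n} G v σ legal S? safe = begin
    count S?           ≡⟨ ∣⟨⟩∣ S? ⟨
    ∣ ⟨ S? ⟩ ∣         ≤⟨ p⊆q⇒∣p∣≤∣q∣ (λ w∈ → x∉p⇒x∈∁p (safe n (∈⟨⟩⁻ S? w∈))) ⟩
    ∣ ∁ (burning n) ∣  ≤⟨ proj₂ (sn-isMax 2 G v) (σ , legal , _ , final-saved G ⁅ v ⁆ ∅ σ , refl) ⟩
    sn 2 G v           ∎
    where
    open ≤-Reasoning
    open Process G ⁅ v ⁆ ∅ σ

  -- Two firefighters per step contain a fire in the square grid: the cell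
  -- (suc x , suc y) burns from time t on, for every entry (t , x , y) of
  -- burnt-cells, and the two cells of wall t are protected at time t + 1.  The
  -- fire starts at the cell (5 , 2).
  burnt-cells : List (ℕ × ℕ × ℕ)
  burnt-cells =
    (0 , 4 , 1) ∷ (1 , 3 , 1) ∷ (1 , 4 , 2) ∷ (2 , 2 , 1) ∷ (2 , 3 , 2) ∷ (2 , 3 , 0) ∷
    (3 , 1 , 1) ∷ (3 , 2 , 2) ∷ (3 , 3 , 3) ∷ (4 , 0 , 1) ∷ (4 , 1 , 2) ∷ (4 , 2 , 3) ∷
    (5 , 0 , 2) ∷ (5 , 1 , 3) ∷ (5 , 2 , 4) ∷ (6 , 0 , 3) ∷ (6 , 1 , 4) ∷ (7 , 0 , 4) ∷ []

  wall : ℕ → (ℕ × ℕ) × (ℕ × ℕ)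
  wall 0 = (6 , 2) , (5 , 1)
  wall 1 = (6 , 3) , (5 , 4)
  wall 2 = (4 , 0) , (3 , 1)
  wall 3 = (2 , 1) , (4 , 5)
  wall 4 = (1 , 1) , (0 , 2)
  wall 5 = (0 , 3) , (3 , 6)
  wall 6 = (2 , 6) , (0 , 4)
  -- These cells complete the wall; later steps merely protect them again.
  wall _ = (1 , 6) , (0 , 5)

  BurntBy WalledBy Reached : ℕ → ℕ × ℕ → Set
  BurntBy t (x , y) = Any (λ (t′ , x′ , y′) → t′ ≤ t × x ≡ suc x′ × y ≡ suc y′) burnt-cells
  WalledBy t z      = Any (λ s → z ≡ proj₁ (wall s) ⊎ z ≡ proj₂ (wall s)) (upTo t)
  Reached t z       = BurntBy t z ⊎ WalledBy t z

  reached? : ∀ t → Decidable (Reached t)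
  reached? t z =
    Any.any? (λ (t′ , x′ , y′) → t′ ≤? t ×-dec (proj₁ z ℕ.≟ suc x′ ×-dec proj₂ z ℕ.≟ suc y′)) burnt-cells
    ⊎-dec
    Any.any? (λ s → ≡-dec ℕ._≟_ ℕ._≟_ z (proj₁ (wall s)) ⊎-dec ≡-dec ℕ._≟_ ℕ._≟_ z (proj₂ (wall s))) (upTo t)

  reached-mono : ∀ {s t z} → s ≤ t → Reached (suc s) z → Reached (suc t) z
  reached-mono s≤t (inj₁ burnt)  = inj₁ (Any.map (λ (t′≤ , eqs) → ≤-trans t′≤ (s≤s s≤t) , eqs) burnt)
  reached-mono s≤t (inj₂ walled) with find walled
  ... | s′ , s′∈ , on = inj₂ (lose (∈-upTo⁺ (<-≤-trans (∈-upTo⁻ s′∈) (s≤s s≤t))) on)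

  -- The certificate for containment, checked by evaluation: whatever a burning cell could ignite in
  -- the next step burns in the list or is walled by then. The bound 5 keeps all four neighbours
  -- within the 7 by 7 patch.
  Contained : ℕ × ℕ × ℕ → Set
  Contained (t , x , y) =
    (x < 5 × y < 5) ×
    Reached (suc t) (suc (suc x) , suc y) × Reached (suc t) (suc x , suc (suc y)) ×
    Reached (suc t) (x , suc y) × Reached (suc t) (suc x , y)

  contained? : Decidable Contained
  contained? (t , x , y) =
    (x ℕ.<? 5 ×-dec y ℕ.<? 5) ×-dec
    (reached? (suc t) _ ×-dec (reached? (suc t) _ ×-dec (reached? (suc t) _ ×-dec reached? (suc t) _)))

  opaque
    all-contained : All Contained burnt-cells
    all-contained = toWitness {a? = All.all? contained? burnt-cells} _

  module Grid {n} (G : Graph n) (R : Rotation G) where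
    open Graph G
    open Embedded G R

    next′-reflects : ∀ {u w} → Adj u (next′ u w) → Adj u w
    next′-reflects {u} {w} a with adj? u w
    ... | yes a′ = a′
    ... | no _   = a

    -- A dart looks east from its source; X and Y move it one step to the east
    -- and to the north in a grid.
    opaque
      X Y : D → D
      X d = rot (rot (rev d))
      Y d = rot (rev (rot d))

      X-injective : Injective _≡_ _≡_ X
      X-injective eq = rev-injective (rot-injective (rot-injective eq))

      Y-injective : Injective _≡_ _≡_ Y
      Y-injective eq = rot-injective (rev-injective (rot-injective eq))

      X-dart : ∀ {e} → IsDart e → IsDart (X e)
      X-dart a = next′-adj (next′-adj (adj-sym a))

      Y-dart : ∀ {e} → IsDart e → IsDart (Y e)
      Y-dart a = next′-adj (adj-sym (next′-adj a))

      X-reflects : ∀ {e} → IsDart (X e) → IsDart e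
      X-reflects a = adj-sym (next′-reflects (next′-reflects a))

      Y-reflects : ∀ {e} → IsDart (Y e) → IsDart e
      Y-reflects a = next′-reflects (adj-sym (next′-reflects a))

      -- The square to the north of `e` has the facial walk `rev e`, `rot e`, `Y e`, `φ (Y e)`. As
      -- it closes up and the vertex to the east returns after four turns, `φ (Y e)` is also the
      -- reverse of `rot (X e)` turned twice more than `rev e` by `rot`; both orders of the moves
      -- apply `rot` to this dart.
      commute : ∀ e → φ (φ (φ (φ (rev e)))) ≡ rev e → rot (rot (rot (rot (X e)))) ≡ X e → X (Y e) ≡ Y (X e)
      commute e q f = cong rot (φ-injective (trans q (sym (rot-injective (rot-injective f)))))

      source-X : ∀ e → proj₁ (X e) ≡ proj₂ e
      source-X e = refl

      source-Y : ∀ e → proj₁ (Y e) ≡ next′ (proj₁ e) (proj₂ e)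
      source-Y e = refl

      -- Two of the four turns take `X e` back to looking west, at the source of `e`; in
      -- `source-Y⁻`, three turns look south.
      source-X⁻ : ∀ e → rot (rot (rot (rot (X e)))) ≡ X e → proj₁ e ≡ proj₂ (rot (rot (X e)))
      source-X⁻ e f = cong proj₂ (sym (rot-injective (rot-injective f)))

      source-Y⁻ : ∀ e → rot (rot (rot (rot (Y e)))) ≡ Y e → proj₁ e ≡ proj₂ (rot (rot (rot (Y e))))
      source-Y⁻ e f = cong proj₂ (sym (rot-injective f))

    -- Along the bottom row first, then north. That steps to the east stay consistent higher up is
    -- `X-at`, and requires a regular patch.
    at : D → ℕ → ℕ → D
    at d x y = fold (fold d X x) Y y

    fold-preserves : (P : Pred D 0ℓ) {f : D → D} → (∀ {e} → P e → P (f e)) → ∀ k {e} → P e → P (fold e f k)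
    fold-preserves P step zero    p = p
    fold-preserves P step (suc k) p = step (fold-preserves P step k p)

    fold-reflects : (P : Pred D 0ℓ) {f : D → D} → (∀ {e} → P (f e) → P e) → ∀ k {e} → P (fold e f k) → P e
    fold-reflects P back zero    p = p
    fold-reflects P back (suc k) p = fold-reflects P back k (back p)

    fold-injective : ∀ {f : D → D} → Injective _≡_ _≡_ f → ∀ k → Injective _≡_ _≡_ (λ e → fold e f k)
    fold-injective inj zero    eq = eq
    fold-injective inj (suc k) eq = fold-injective inj k (inj eq)

    at-injective : ∀ x y → Injective _≡_ _≡_ (λ d → at d x y)
    at-injective x y = fold-injective X-injective x ∘ fold-injective Y-injective y

    at-dart : ∀ {d} x y → IsDart d → IsDart (at d x y)
    at-dart x y = fold-preserves IsDart Y-dart y ∘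
                  fold-preserves IsDart X-dart x

    at-reflects : ∀ {d} x y → IsDart (at d x y) → IsDart d
    at-reflects x y = fold-reflects IsDart X-reflects x ∘ fold-reflects IsDart Y-reflects y

    IrregularAt : Fin 7 → Fin 7 → Pred D 0ℓ
    IrregularAt i j d = NotFour (at d (toℕ i) (toℕ j)) ⊎ NonQuad (rev (at d (toℕ i) (toℕ j)))

    irregularAt? : ∀ i j → Decidable (IrregularAt i j)
    irregularAt? i j d = notFour? (at d (toℕ i) (toℕ j)) ⊎-dec nonQuad? (rev (at d (toℕ i) (toℕ j)))

    Irregular : Pred D 0ℓ
    Irregular d = ∃[ i ] ∃[ j ] IrregularAt i j d

    irregular? : Decidable Irregular
    irregular? d = any? λ i → any? λ j → irregularAt? i j d

    count-irregularAt : ∀ i j → count (irregularAt? i j) ≤ count notFour? + count nonQuad?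
    count-irregularAt i j = ≤-trans
      (count-⊎ (irregularAt? i j) (λ d → notFour? (at d (toℕ i) (toℕ j)))
          (λ d → nonQuad? (rev (at d (toℕ i) (toℕ j)))) id)
      (+-mono-≤ (count-image notFour? (λ d → at d (toℕ i) (toℕ j)) (at-injective (toℕ i) (toℕ j)))
                (count-image nonQuad? (λ d → rev (at d (toℕ i) (toℕ j)))
                    (at-injective (toℕ i) (toℕ j) ∘ rev-injective)))

    -- The map from a dart to the dart at a fixed position is injective, so each of the 49 positions
    -- contributes at most `b`.
    count-irregular-patch : ∀ {b} → count notFour? + count nonQuad? ≤ b → count irregular? ≤ 7 * (7 * b)
    count-irregular-patch {b} bound =
      count-∃ {k = 7} {b = 7 * b} (λ i d → any? λ j → irregularAt? i j d) λ i →
      count-∃ {k = 7} {b = b} (irregularAt? i) λ j → ≤-trans (count-irregularAt i j) bound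

    opaque
      centre : D → D
      centre d = at d 5 2

      centre-injective : Injective _≡_ _≡_ centre
      centre-injective = at-injective 5 2

      centre-reflects : ∀ {d} → IsDart (centre d) → IsDart d
      centre-reflects = at-reflects 5 2

      source-centre : ∀ d → proj₁ (centre d) ≡ proj₁ (at d 5 2)
      source-centre d = refl

    module Regular (d : D) (a : IsDart d) (regular : ¬ Irregular d) where

      four : ∀ {x y} → x < 7 → y < 7 → rot (rot (rot (rot (at d x y)))) ≡ at d x y
      four {x} {y} x< y< = decidable-stable (rot (rot (rot (rot (at d x y)))) ≟ᴰ at d x y) λ ≢ → regular
        (fromℕ< x< , fromℕ< y< , inj₁ (subst NotFour (sym (cong₂ (at d) (toℕ-fromℕ< x<) (toℕ-fromℕ< y<)))
            (at-dart x y a , ≢)))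

      quad : ∀ {x y} → x < 7 → y < 7 → φ (φ (φ (φ (rev (at d x y))))) ≡ rev (at d x y)
      quad {x} {y} x< y< = decidable-stable (φ (φ (φ (φ (rev (at d x y))))) ≟ᴰ rev (at d x y)) λ ≢ → regular
        (fromℕ< x< , fromℕ< y< , inj₂ (subst (NonQuad ∘ rev)
            (sym (cong₂ (at d) (toℕ-fromℕ< x<) (toℕ-fromℕ< y<))) (rev-dart (at-dart x y a) , ≢)))

      X-at : ∀ {x y} → x < 6 → y < 7 → X (at d x y) ≡ at d (suc x) y
      X-at {x} {zero}  x< y< = refl
      X-at {x} {suc y} x< y< = trans
        (commute (at d x y) (quad (m<n⇒m<1+n x<) y<′)
            (subst (λ e → rot (rot (rot (rot e))) ≡ e) (sym (X-at x< y<′)) (four (s<s x<) y<′)))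
        (cong Y (X-at x< y<′))
        where y<′ = <-trans (n<1+n y) y<

      cell : ℕ × ℕ → Fin n
      cell (x , y) = proj₁ (at d x y)

      neighbours : ∀ {x y} → x < 5 → y < 5 → ∀ {w} → Adj (cell (suc x , suc y)) w →
                   (w ≡ cell (suc (suc x) , suc y) ⊎ w ≡ cell (suc x , suc (suc y))) ⊎
                   (w ≡ cell (x , suc y) ⊎ w ≡ cell (suc x , y))
      neighbours {x} {y} x< y< b = locate (four-neighbours (at-dart (suc x) (suc y) a) r⁴ b)
        where
        x<6 = m<n⇒m<1+n x<
        y<6 = m<n⇒m<1+n y<
        e west south : D
        e     = at d (suc x) (suc y)
        west  = at d x (suc y)
        south = at d (suc x) y
        r⁴ : rot (rot (rot (rot e))) ≡ e
        r⁴ = four (s<s x<6) (s<s y<6)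
        -- By definition `e` is `Y south`, but to be `X west` it needs the squares of the patch to
        -- close.
        X-west : X west ≡ e
        X-west = X-at x<6 (s<s y<6)
        locate : ∀ {w} → w ∈ᴸ proj₂ e ∷ proj₂ (rot e) ∷ proj₂ (rot (rot e)) ∷ proj₂ (rot (rot (rot e))) ∷ [] →
                 (w ≡ cell (suc (suc x) , suc y) ⊎ w ≡ cell (suc x , suc (suc y))) ⊎
                 (w ≡ cell (x , suc y) ⊎ w ≡ cell (suc x , y))
        locate (here eq) =
          inj₁ (inj₁ (trans eq (trans (sym (source-X e)) (cong proj₁ (X-at (s<s x<) (s<s y<6))))))
        locate (there (here eq)) =
          inj₁ (inj₂ (trans eq (sym (source-Y e))))
        locate (there (there (here eq))) =
          inj₂ (inj₁ (trans eq (sym (subst (λ f → rot (rot (rot (rot f))) ≡ f → proj₁ west ≡ proj₂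
              (rot (rot f))) X-west (source-X⁻ west) r⁴))))
        locate (there (there (there (here eq)))) =
          inj₂ (inj₂ (trans eq (sym (source-Y⁻ south r⁴))))

      Image : ℕ → Pred (Fin n) 0ℓ
      Image t w = Any (λ (t′ , x , y) → t′ ≤ t × w ≡ cell (suc x , suc y)) burnt-cells

      image? : ∀ t → Decidable (Image t)
      image? t w = Any.any? (λ (t′ , x , y) → t′ ≤? t ×-dec w ≟ cell (suc x , suc y)) burnt-cells

      image-mono : ∀ {s t w} → s ≤ t → Image s w → Image t w
      image-mono s≤t = Any.map λ (t′≤ , eq) → ≤-trans t′≤ s≤t , eq

      -- The map from cells to vertices need not be injective: the vertex of a
      -- cell of the wall may burn already, being also the vertex of a burning cell.
      Chosen : ℕ → Pred (Fin n) 0ℓ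
      Chosen t w = (w ≡ cell (proj₁ (wall t)) ⊎ w ≡ cell (proj₂ (wall t))) × ¬ Image t w

      chosen? : ∀ t → Decidable (Chosen t)
      chosen? t w = (w ≟ cell (proj₁ (wall t)) ⊎-dec w ≟ cell (proj₂ (wall t))) ×-dec ¬? (image? t w)

      σ : Strategy n
      σ t = ⟨ chosen? t ⟩

      v : Fin n
      v = cell (5 , 2)

      open Process G ⁅ v ⁆ ∅ σ

      chosen-protected : ∀ {s t w} → s < t → Chosen s w → w ∈ protected t
      chosen-protected {s} {suc t} s<t c with m≤n⇒m<n∨m≡n (s≤s⁻¹ s<t)
      ... | inj₁ s<t′ = p⊆p∪q (σ t) (chosen-protected s<t′ c)
      ... | inj₂ refl = q⊆p∪q (protected t) (σ t) (∈⟨⟩⁺ (chosen? t) c)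

      reached : ∀ {t z w} → w ≡ cell z → Reached t z → w ∉ protected t → Image t w
      reached w≡ (inj₁ burnt) w∉ = Any.map (λ { (t′≤ , refl , refl) → t′≤ , w≡ }) burnt
      reached {t} {z} {w} w≡ (inj₂ walled) w∉ with find walled
      ... | s , s∈ , on with image? s w
      ...   | yes im = image-mono (<⇒≤ (∈-upTo⁻ s∈)) im
      ...   | no ¬im = contradiction (chosen-protected (∈-upTo⁻ s∈) (Sum.map vertex vertex on , ¬im)) w∉
        where
        vertex : ∀ {z′} → z ≡ z′ → w ≡ cell z′
        vertex refl = w≡

      -- Equality may fail, as a protected vertex can also be the vertex of a cell that burns later;
      -- the inclusion is all that is needed.
      burning⊆image : ∀ t {w} → w ∈ burning t → Image t w
      burning⊆image zero    w∈ = here (z≤n , x∈⁅y⁆⇒x≡y v w∈)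
      burning⊆image (suc t) {w} w∈ with spread⁻ G (burning t) (protected (suc t)) w∈
      ... | inj₁ old = image-mono (n≤1+n t) (burning⊆image t old)
      ... | inj₂ (w∉ , u , u∈ , uw) with find (burning⊆image t u∈)
      ...   | (t′ , x , y) , z∈ , t′≤t , refl with All.lookup all-contained z∈
      ...     | (x< , y<) , east , north , west , south with neighbours x< y< uw
      ...       | inj₁ (inj₁ eq) = reached eq (reached-mono t′≤t east) w∉
      ...       | inj₁ (inj₂ eq) = reached eq (reached-mono t′≤t north) w∉
      ...       | inj₂ (inj₁ eq) = reached eq (reached-mono t′≤t west) w∉
      ...       | inj₂ (inj₂ eq) = reached eq (reached-mono t′≤t south) w∉

      legal : Legal 2
      legal t = subst (_≤ 2) (sym (∣⟨⟩∣ (chosen? t)))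
                  (count≤length (chosen? t) (cell (proj₁ (wall t)) ∷ cell (proj₂ (wall t)) ∷ [])
                    λ { (inj₁ eq , _) → here eq ; (inj₂ eq , _) → there (here eq) }) ,
                λ w∈ → x∉p⇒x∈∁p λ b → proj₂ (∈⟨⟩⁻ (chosen? t) w∈) (burning⊆image t b)

      saved : n ≤ 18 + sn 2 G v
      saved = begin
        n                                           ≡⟨ count-∁ hit? ⟨
        count hit? + count (λ w → ¬? (hit? w))
            ≤⟨ +-mono-≤ (count≤length hit? cells id) (saves G v σ legal (λ w → ¬? (hit? w)) λ t ¬hit b → ¬hit
            (image-hit (burning⊆image t b))) ⟩
        18 + sn 2 G v                               ∎
        where
        open ≤-Reasoning
        cells : List (Fin n)
        cells = List.map (λ (_ , x , y) → cell (suc x , suc y)) burnt-cells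
        hit? : Decidable (_∈ᴸ cells)
        hit? w = Any.any? (w ≟_) cells
        image-hit : ∀ {t w} → Image t w → w ∈ᴸ cells
        image-hit = map⁺ ∘ Any.map proj₂

  -- The contour of a forest and its chords

  ∑-member : ∀ {A : Set} {{FA : Finite A}} (f : A → ℕ) x → f x ≤ ∑ f
  ∑-member f x = subst (_≤ ∑ f) (+-identityʳ (f x)) (∑-unique {xs = x ∷ []} ([] ∷ []) f)

  count-positive : ∀ {A : Set} {{FA : Finite A}} {P : Pred A 0ℓ} (P? : Decidable P) {x} → P x → 1 ≤ count P?
  count-positive P? {x} p = subst (_≤ count P?) (ind-yes (P? x) p) (∑-member (λ x → ind (P? x)) x)

  opaque
    unfolding ∑

    count-suc : ∀ {m} {P : Pred (Fin (suc m)) 0ℓ} (P? : Decidable P) →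
        count P? ≡ ind (P? zero) + count (P? ∘ suc)
    count-suc P? = refl

  -- Identifying the ends of an edge decreases the number of classes at most by one.
  record Quotient {c m} (ends : Fin m → Fin c × Fin c) {P : Pred (Fin m) 0ℓ} (P? : Decidable P) : Set where
    field
      classes    : ℕ
      class      : Fin c → Fin classes
      surjective : ∀ j → ∃[ x ] class x ≡ j
      bound      : c ≤ classes + count P?
      identified : ∀ i → P i → class (proj₁ (ends i)) ≡ class (proj₂ (ends i))

  identify : ∀ {k} {a b : Fin (suc k)} → b ≢ a →
             ∃[ g ] (g a ≡ g b × ∀ (j : Fin k) → ∃[ x ] g x ≡ j)
  identify {k} {a} {b} b≢a = g , trans (g-≢ b≢a) (sym g-b) , λ j → punchIn b j ,
      trans (g-≢ (≢-sym (punchInᵢ≢i b j))) (trans (punchOut-cong b refl) (punchOut-punchIn b))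
    where
    g : Fin (suc k) → Fin k
    g x with b ≟ x
    ... | yes _  = punchOut b≢a
    ... | no b≢x = punchOut b≢x
    g-b : g b ≡ punchOut b≢a
    g-b with b ≟ b
    ... | yes _  = refl
    ... | no b≢b = contradiction refl b≢b
    g-≢ : ∀ {x} (b≢x : b ≢ x) → g x ≡ punchOut b≢x
    g-≢ {x} b≢x with b ≟ x
    ... | yes b≡x = contradiction b≡x b≢x
    ... | no _    = punchOut-cong b refl

  quotient : ∀ {c m} (ends : Fin m → Fin c × Fin c) {P : Pred (Fin m) 0ℓ} (P? : Decidable P) →
      Quotient ends P?
  quotient {c} {zero} ends P? = record
    { class = id ; surjective = λ j → j , refl ; bound = m≤m+n c _ ; identified = λ () }
  quotient {c} {suc m} ends {P} P? = add
    where
    open Quotient (quotient (ends ∘ suc) (P? ∘ suc))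
    u w : Fin c
    u = proj₁ (ends zero)
    w = proj₂ (ends zero)

    extend : ∀ (ok : P zero → class u ≡ class w) i → P i → class (proj₁ (ends i)) ≡ class (proj₂ (ends i))
    extend ok zero    = ok
    extend ok (suc i) = identified i

    bound′ : c ≤ classes + count P?
    bound′ = ≤-trans bound (+-monoʳ-≤ classes
        (≤-trans (m≤n+m _ (ind (P? zero))) (≤-reflexive (sym (count-suc P?)))))

    glue : ∀ {k} → k ≡ classes → (f : Fin c → Fin k) → (∀ j → ∃[ x ] f x ≡ j) →
           (∀ i → P (suc i) → f (proj₁ (ends (suc i))) ≡ f (proj₂ (ends (suc i)))) → P zero → f w ≢ f u →
               Quotient ends P?
    glue {zero}  eq f _ _ _ _ with () ← f u
    glue {suc k} eq f sur same p b≢a with identify b≢a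
    ... | g , ga≡gb , g-sur = record
      { class      = g ∘ f
      ; surjective = λ j → let x , gx≡j = g-sur j ; y , fy≡x = sur x in y , trans (cong g fy≡x) gx≡j
      ; bound      = ≤-trans (subst (λ l → c ≤ l + count (P? ∘ suc)) (sym eq) bound)
          (≤-reflexive (trans (sym (+-suc k _)) (cong (k +_)
                       (trans (cong (_+ count (P? ∘ suc)) (sym (ind-yes (P? zero) p)))
                           (sym (count-suc P?))))))
      ; identified = λ { zero _ → ga≡gb ; (suc i) q → cong g (same i q) }
      }

    add : Quotient ends P?
    add with P? zero | class w ≟ class u
    ... | no ¬p | _      = record { class = class ; surjective = surjective ; bound = bound′
                                  ; identified = extend λ p → contradiction p ¬p }
    ... | yes _ | yes eq = record { class = class ; surjective = surjective ; bound = bound′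
                                  ; identified = extend λ _ → sym eq }
    ... | yes p | no ≢   = glue refl class surjective identified p ≢

  module Forest {n} (G : Graph n) (R : Rotation G) (S : Spherical G R) (r : Fin n) where
    open Graph G
    open Sphere G R S r public

    -- The component of the fire is rooted at `r`, so that `depth` is there the distance from the
    -- fire.
    rootOf : Fin C → Fin n
    rootOf c with c ≟ comp r
    ... | yes _ = r
    ... | no _  = Inverse.from components c

    comp-rootOf : ∀ c → comp (rootOf c) ≡ c
    comp-rootOf c with c ≟ comp r
    ... | yes eq = sym eq
    ... | no _   = Inverse.strictlyInverseˡ components c

    root : Fin n → Fin n
    root u = rootOf (comp u)

    root-r : root r ≡ r
    root-r with comp r ≟ comp r
    ... | yes _ = refl
    ... | no ≢  = contradiction refl ≢

    root-adj : ∀ {u w} → Adj u w → root u ≡ root w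
    root-adj a = cong rootOf (comp-adj a)

    root-root : ∀ u → root (root u) ≡ root u
    root-root u = cong rootOf (comp-rootOf (comp u))

    Walk : ℕ → Pred (Fin n) 0ℓ
    Walk zero    u = u ≡ root u
    Walk (suc t) u = ∃[ w ] (Adj w u × Walk t w)

    walk? : ∀ t → Decidable (Walk t)
    walk? zero    u = u ≟ root u
    walk? (suc t) u = any? λ w → adj? w u ×-dec walk? t w

    walk : ∀ u → ∃[ t ] Walk t u
    walk u = go (class-injective components (comp-rootOf (comp u))) (0 , sym (root-root u))
      where
      go : ∀ {x y} → Setoid._≈_ (Components G) x y → ∃[ t ] Walk t x → ∃[ t ] Walk t y
      go ε           w       = w
      go (fwd a ◅ s) (t , w) = go s (suc t , _ , a , w)
      go (bwd a ◅ s) (t , w) = go s (suc t , _ , adj-sym a , w)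

    opaque
      depth : Fin n → ℕ
      depth u = proj₁ (least (λ t → walk? t u) (proj₁ (walk u)) (proj₂ (walk u)))

      depth-walk : ∀ u → Walk (depth u) u
      depth-walk u = proj₁ (proj₂ (least (λ t → walk? t u) (proj₁ (walk u)) (proj₂ (walk u))))

      depth-least : ∀ {t u} → Walk t u → depth u ≤ t
      depth-least {t} {u} w = ≮⇒≥ λ t< →
        proj₂ (proj₂ (least (λ t → walk? t u) (proj₁ (walk u)) (proj₂ (walk u)))) t t< w

    depth-adj : ∀ {u w} → Adj u w → depth w ≤ suc (depth u)
    depth-adj {u} a = depth-least (u , a , depth-walk u)

    depth-root : ∀ {u} → u ≡ root u → depth u ≡ 0
    depth-root eq = n≤0⇒n≡0 (depth-least eq)

    opaque
      -- The last vertex but one of a shortest walk from the root; a root is its own parent.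
      parent : Fin n → Fin n
      parent u = go (depth u) (depth-walk u)
        where
        go : ∀ t → Walk t u → Fin n
        go zero    _       = u
        go (suc t) (w , _) = w

      parent-spec : ∀ u → (u ≡ root u × parent u ≡ u) ⊎ (Adj u (parent u) × depth u ≡ suc (depth (parent u)))
      parent-spec u with depth u in eq | depth-walk u
      ... | zero  | isRoot     = inj₁ (isRoot , refl)
      ... | suc t | w , a , wt = inj₂ (adj-sym a , cong suc (≤-antisym
        (s≤s⁻¹ (subst (_≤ suc (depth w)) eq (depth-adj a))) (depth-least wt)))

    child-spec : ∀ {u x} → Adj u x → parent x ≡ u → depth x ≡ suc (depth u)
    child-spec {u} {x} a refl with parent-spec x
    ... | inj₁ (_ , eq) = contradiction (subst (λ y → Adj y x) eq a) (loopless G)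
    ... | inj₂ (_ , eq) = eq

    Tree : Pred D 0ℓ
    Tree (u , w) = parent u ≡ w ⊎ parent w ≡ u

    tree? : Decidable Tree
    tree? (u , w) = parent u ≟ w ⊎-dec parent w ≟ u

    pass : ∀ {d} → Dec (Tree d) → D
    pass {d} (yes _) = rev d
    pass {d} (no _)  = d

    opaque
      -- One step along the contour of the forest, crossing the chords.
      κ : D → D
      κ d = rot (pass (tree? d))

      κ-tree : ∀ {d} → Tree d → κ d ≡ φ d
      κ-tree {d} t = cong rot (crosses (tree? d))
        where
        crosses : ∀ t? → pass {d} t? ≡ rev d
        crosses (yes _) = refl
        crosses (no ¬t) = contradiction t ¬t

      κ-chord : ∀ {d} → ¬ Tree d → κ d ≡ rot d
      κ-chord {d} ¬t = cong rot (stays (tree? d))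
        where
        stays : ∀ t? → pass {d} t? ≡ d
        stays (yes t) = contradiction t ¬t
        stays (no _)  = refl

      κ-injective : Injective _≡_ _≡_ κ
      κ-injective {d} {e} eq = by-cases (tree? d) (tree? e) (rot-injective eq)
        where
        by-cases : ∀ t? t?′ → pass {d} t? ≡ pass {e} t?′ → d ≡ e
        by-cases (yes _) (yes _) eq   = rev-injective eq
        by-cases (no _)  (no _)  eq   = eq
        by-cases (yes t) (no ¬t) refl = contradiction (Sum.swap t) ¬t
        by-cases (no ¬t) (yes t) refl = contradiction (Sum.swap t) ¬t

    κ-dart : ∀ {d} → IsDart d → IsDart (κ d)
    κ-dart {d} a with tree? d
    ... | yes t = subst IsDart (sym (κ-tree t)) (φ-dart a)
    ... | no ¬t = subst IsDart (sym (κ-chord ¬t)) (rot-dart a)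

    module Contour (Q : Pred D 0ℓ) (Q-κ : ∀ {d} → IsDart d → Q d → Q (κ d)) where

      private
        turn-back : ∀ {u x} → Adj u x → Tree (x , u) → Q (x , u) → Q (u , next′ u x)
        turn-back a t q = subst Q (κ-tree t) (Q-κ (adj-sym a) q)

        advance : ∀ {u x} → Adj u x → x ≢ parent u → (parent x ≡ u → Q (u , x) → Q (x , u)) → Q (u , x) →
            Q (u , next′ u x)
        advance {u} {x} a x≢ down q with tree? (u , x)
        ... | no ¬t           = subst Q (κ-chord ¬t) (Q-κ a q)
        ... | yes (inj₁ eq)   = contradiction (sym eq) x≢
        ... | yes (inj₂ refl) = turn-back a (inj₁ refl) (down refl q)

        -- Having entered the subtree of `u`, the contour leaves it again. The induction goes away
        -- from the root; `m` is its fuel, with `∑ depth` as a crude bound for the depth of every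
        -- vertex.
        ascend : ∀ m {u} → ∑ depth < depth u + m → Adj u (parent u) → Q (parent u , u) → Q (u , parent u)
        ascend zero    {u} high a q =
            contradiction (∑-member depth u) (<⇒≱ (subst (∑ depth <_) (+-identityʳ _) high))
        ascend (suc m) {u} high a q = Sum.[ id , id ]
          (around-induct (λ x → Q (u , x) ⊎ Q (u , parent u)) step (next′-adj a)
              (inj₁ (turn-back a (inj₂ refl) q)) a)
          where
          -- The second alternative records that the parent has been reached: the invariant must not
          -- be pushed past it.
          step : ∀ {x} → Adj u x → Q (u , x) ⊎ Q (u , parent u) → Q (u , next′ u x) ⊎ Q (u , parent u)
          step b (inj₂ q) = inj₂ q
          step {x} b (inj₁ q) with x ≟ parent u
          ... | yes refl = inj₂ q
          ... | no x≢    = inj₁ (advance b x≢ down q)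
            where
            down : parent x ≡ u → Q (u , x) → Q (x , u)
            down refl = ascend m (subst (∑ depth <_)
                (trans (+-suc (depth u) m) (cong (_+ m) (sym (child-spec b refl)))) high) (adj-sym b)

        advance′ : ∀ {u x} → Adj u x → x ≢ parent u → Q (u , x) → Q (u , next′ u x)
        advance′ {u} {x} a x≢ = advance a x≢ down
          where
          down : parent x ≡ u → Q (u , x) → Q (x , u)
          down refl = ascend (suc (∑ depth)) (m≤n+m _ _) (adj-sym a)

      -- The contour of each tree is a single cycle through all darts of its component, stated as an
      -- induction principle: an invariant of `κ` spreads from one dart at the root.
      visits : ∀ {ρ} → (∀ {w} → Adj ρ w → ∃[ w₀ ] (Adj ρ w₀ × Q (ρ , w₀))) → ∀ k {u} → depth u ≡ k →
          root u ≡ ρ →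
               ∀ {w} → Adj u w → Q (u , w)
      visits {ρ} start k {u} d r≡ρ a with parent-spec u
      visits {ρ} start k {u} d r≡ρ a | inj₁ (isRoot , pu) with trans isRoot r≡ρ
      ... | refl with start a
      ...   | w₀ , a₀ , q₀ = around-induct (λ x → Q (u , x))
        (λ {x} b → advance′ b λ eq → loopless G (subst (Adj u) (trans eq pu) b)) a₀ q₀ a
      visits {ρ} start zero    {u} d r≡ρ a | inj₂ (up , eq) = contradiction (trans (sym d) eq) λ ()
      visits {ρ} start (suc k) {u} d r≡ρ a | inj₂ (up , eq) =
        around-induct (λ x → Q (u , x)) step (next′-adj up) first a
        where
        first : Q (u , next′ u (parent u))
        first = turn-back up (inj₂ refl)
          (visits start k (ℕ.suc-injective (trans (sym eq) d)) (trans (sym (root-adj up)) r≡ρ) (adj-sym up))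
        step : ∀ {x} → Adj u x → Q (u , x) → Q (u , next′ u x)
        step {x} b q with x ≟ parent u
        ... | yes refl = first
        ... | no x≢    = advance′ b x≢ q

    endsOf : Fin E → D
    endsOf i = Dart.source (Inverse.from edges i) , Dart.target (Inverse.from edges i)

    endsOf-dart : ∀ i → IsDart (endsOf i)
    endsOf-dart i = Dart.adj (Inverse.from edges i)

    edge-endsOf : ∀ i → edge (endsOf-dart i) ≡ i
    edge-endsOf = Inverse.strictlyInverseˡ edges

    endsOf-edge : ∀ {d} (a : IsDart d) → d ≡ endsOf (edge a) ⊎ d ≡ rev (endsOf (edge a))
    endsOf-edge a = edge-injective (endsOf-dart (edge a)) a (edge-endsOf (edge a))

    sideAt-dart : ∀ {u w} → Adj u w → ∃[ w₀ ] ∃[ a ] sideAt u ≡ along (dart {target = w₀} a)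
    sideAt-dart {u} {w} a with any? (adj? u)
    ... | yes (w₀ , a₀) = w₀ , a₀ , refl
    ... | no isolated   = contradiction (w , a) isolated

    sideAt-around : ∀ {u} (iso : ∀ w → ¬ Adj u w) → faceOf (sideAt u) ≡ faceOf (around u iso)
    sideAt-around {u} iso with any? (adj? u)
    ... | yes (w₀ , a₀) = contradiction a₀ (iso w₀)
    ... | no _          = Inverse.to-cong faces (return (stay _ _))

    isRoot? : Decidable (λ u → u ≡ root u)
    isRoot? u = u ≟ root u

    treeEdge? : Decidable (Tree ∘ endsOf)
    treeEdge? i = tree? (endsOf i)

    count-roots : count isRoot? ≤ C
    count-roots = ≤-trans
      (count-injective {Q = λ _ → ⊤} isRoot? (λ _ → yes tt) comp (λ _ → tt)
        λ isRoot isRoot′ eq → trans isRoot (trans (cong rootOf eq) (sym isRoot′)))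
      (count≤size {Fin C} (λ _ → yes tt))

    -- A vertex other than a root is charged with the edge to its parent. Two vertices with the same
    -- edge would be parents of each other, which the depths forbid.
    count-nonroots : count (λ u → ¬? (isRoot? u)) ≤ count treeEdge?
    count-nonroots = count-injective-on (λ u → ¬? (isRoot? u)) treeEdge? (λ {u} ¬root → edge (up ¬root))
        isTree inj
      where
      up : ∀ {u} → u ≢ root u → Adj u (parent u)
      up {u} ¬root with parent-spec u
      ... | inj₁ (isRoot , _) = contradiction isRoot ¬root
      ... | inj₂ (a , _)      = a
      isTree : ∀ {u} (¬root : u ≢ root u) → Tree (endsOf (edge (up ¬root)))
      isTree {u} ¬root with endsOf-edge (up ¬root)
      ... | inj₁ eq = subst Tree eq (inj₁ refl)
      ... | inj₂ eq = subst Tree (rev-injective eq) (inj₂ refl)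
      inj : ∀ {u w} (p : u ≢ root u) (q : w ≢ root w) → edge (up p) ≡ edge (up q) → u ≡ w
      inj {u} {w} p q eq with edge-injective (up p) (up q) eq | parent-spec u | parent-spec w
      ... | inj₁ eq′ | _                 | _                 = sym (,-injectiveˡ eq′)
      ... | inj₂ eq′ | inj₁ (isRoot , _) | _                 = contradiction isRoot p
      ... | inj₂ eq′ | _                 | inj₁ (isRoot , _) = contradiction isRoot q
      ... | inj₂ eq′ | inj₂ (_ , du)     | inj₂ (_ , dw)     = contradiction
        (trans du (cong suc (trans (cong depth (sym (,-injectiveˡ eq′)))
            (trans dw (cong (suc ∘ depth) (,-injectiveʳ eq′))))))
        (<⇒≢ (s≤s (n≤1+n _)))

    -- Removing one chord from the dual graph of the chords separates the two
    -- faces along it, since there are just enough chords to connect the faces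
    -- within each component.
    record Separation (d : D) : Set where
      field
        {classes} : ℕ
        class     : Fin F → Fin classes
        differ    : class (face d) ≢ class (face (rev d))
        agree     : ∀ {e} → IsDart e → ¬ Tree e → e ≢ d → e ≢ rev d → class (face e) ≡ class (face (rev e))

    opaque
      -- The classes arise by merging the two faces along every chord other than `d`. If the faces
      -- along `d` were merged too, each contour would stay in one class, and each class would be
      -- that of some root, leaving at most `C` classes; there are more.
      separation : ∀ {d} → IsDart d → ¬ Tree d → Separation d
      separation {d} a ¬t = record { class = class ; differ = differ ; agree = agree }
        where
        Other : Pred (Fin E) 0ℓ
        Other i = ¬ Tree (endsOf i) × i ≢ edge a

        other? : Decidable Other
        other? i = ¬? (treeEdge? i) ×-dec ¬? (i ≟ edge a)

        open Quotient (quotient (λ i → face (endsOf i) , face (rev (endsOf i))) other?)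

        agree : ∀ {e} → IsDart e → ¬ Tree e → e ≢ d → e ≢ rev d → class (face e) ≡ class (face (rev e))
        agree {e} b ¬t′ e≢ e≢′ with endsOf-edge b
        ... | inj₁ eq = trans (cong (class ∘ face) eq) (trans
                (identified (edge b) (¬t′ ∘ subst Tree (sym eq) , ≢edge))
                    (cong (class ∘ face ∘ rev) (sym eq)))
          where
          ≢edge : edge b ≢ edge a
          ≢edge eq = Sum.[ e≢ , e≢′ ] (edge-injective a b (sym eq))
        ... | inj₂ eq = trans (cong (class ∘ face) eq) (trans
                (sym (identified (edge b) (¬t′ ∘ subst Tree (sym eq) ∘ Sum.swap , ≢edge)))
                    (cong (class ∘ face ∘ rev) (sym eq)))
          where
          ≢edge : edge b ≢ edge a
          ≢edge eq = Sum.[ e≢ , e≢′ ] (edge-injective a b (sym eq))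

        tree≢edge : ∀ {i} → Tree (endsOf i) → i ≢ edge a
        tree≢edge t refl with endsOf-edge a
        ... | inj₁ eq = ¬t (subst Tree (sym eq) t)
        ... | inj₂ eq = ¬t (subst Tree (sym eq) (Sum.swap t))

        count-other : count other? + count treeEdge? + 1 ≤ E
        count-other = begin
          count other? + count treeEdge? + 1
            ≤⟨ +-mono-≤ (count-disjoint other? treeEdge? (λ i → ¬? (i ≟ edge a)) proj₂ tree≢edge
                λ (¬t , _) t → ¬t t)
                        (count-positive (_≟ edge a) refl) ⟩
          count (λ i → ¬? (i ≟ edge a)) + count (_≟ edge a)
            ≡⟨ trans (+-comm (count (λ i → ¬? (i ≟ edge a))) _) (count-∁ (_≟ edge a)) ⟩
          E ∎
          where open ≤-Reasoning

        -- `F` is at most `classes` plus the other chords, `n` is at most `C` plus the tree edges,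
        -- and the other chords and the tree edges leave out at least one edge. Euler's formula
        -- turns this into a strict bound.
        many-classes : C < classes
        many-classes = +-cancelʳ-≤ (count other? + count treeEdge? + C) _ _ (begin
          suc C + (count other? + count treeEdge? + C)        ≡⟨ regroup C (count other?) (count treeEdge?) ⟩
          (count other? + count treeEdge? + 1) + 2 * C        ≤⟨ +-monoˡ-≤ (2 * C) count-other ⟩
          E + 2 * C                                           ≡⟨ euler ⟨
          n + F                                               ≡⟨ cong (_+ F) (count-∁ isRoot?) ⟨
          count isRoot? + count (λ u → ¬? (isRoot? u)) + F
              ≤⟨ +-mono-≤ (+-mono-≤ count-roots count-nonroots) bound ⟩
          C + count treeEdge? + (classes + count other?)
              ≡⟨ regroup′ C (count treeEdge?) classes (count other?) ⟩
          classes + (count other? + count treeEdge? + C)      ∎)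
          where
          open ≤-Reasoning
          regroup : ∀ c o t → suc c + (o + t + c) ≡ (o + t + 1) + 2 * c
          regroup = solve-∀
          regroup′ : ∀ c t k o → c + t + (k + o) ≡ k + (o + t + c)
          regroup′ = solve-∀

        differ : class (face d) ≢ class (face (rev d))
        differ same = <⇒≱ many-classes (injective⇒≤ {f = comp-of} comp-of-injective)
          where
          rootClass : Fin n → Fin classes
          rootClass ρ = class (faceOf (sideAt ρ))

          crossing : ∀ {e} → IsDart e → ¬ Tree e → class (face e) ≡ class (face (rev e))
          crossing {e} b ¬t with e ≟ᴰ d | e ≟ᴰ rev d
          ... | yes eq | _      = subst (λ e → class (face e) ≡ class (face (rev e))) (sym eq) same
          ... | no _   | yes eq = subst (λ e → class (face e) ≡ class (face (rev e))) (sym eq) (sym same)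
          ... | no e≢  | no e≢′   = agree b ¬t e≢ e≢′

          constant : ∀ ρ {e} → IsDart e → class (face e) ≡ rootClass ρ → class (face (κ e)) ≡ rootClass ρ
          constant ρ {e} b eq with tree? e
          ... | yes t = trans (cong class (trans (cong face (κ-tree t)) (face-φ b))) eq
          ... | no ¬t = trans (cong class (trans (cong face (κ-chord ¬t)) (face-φ (adj-sym b))))
                              (trans (sym (crossing b ¬t)) eq)

          start : ∀ ρ {w} → Adj ρ w → ∃[ w₀ ] (Adj ρ w₀ × class (face (ρ , w₀)) ≡ rootClass ρ)
          start ρ b with sideAt-dart b
          ... | w₀ , a₀ , eq = w₀ , a₀ , cong class (trans (faceOf-along a₀) (cong faceOf (sym eq)))

          side-class : ∀ s → class (faceOf s) ≡ rootClass (root (base s))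
          side-class (along (dart {u} b)) = trans (cong class (sym (faceOf-along b)))
            (Contour.visits (λ e → class (face e) ≡ rootClass (root u)) (constant (root u)) (start (root u))
                (depth u) refl refl b)
          side-class (around u iso) with parent-spec u
          ... | inj₁ (isRoot , _) = trans (cong class (sym (sideAt-around iso))) (cong rootClass isRoot)
          ... | inj₂ (b , _)      = contradiction b (iso _)

          classOf : Fin C → Fin classes
          classOf c = rootClass (rootOf c)

          hit : ∀ j → ∃[ c ] classOf c ≡ j
          hit j with surjective j
          ... | f , eq = comp (base (sideOn f)) ,
            trans (sym (side-class (sideOn f))) (trans (cong class (Inverse.strictlyInverseˡ faces f)) eq)

          comp-of : Fin classes → Fin C
          comp-of j = proj₁ (hit j)

          comp-of-injective : Injective _≡_ _≡_ comp-of
          comp-of-injective {i} {j} eq = trans (sym (proj₂ (hit i))) (trans (cong classOf eq) (proj₂ (hit j)))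

  -- Separating a vertex of low degree

  constant-on : ∀ {A : Set} (f : ℕ → A) {x y} → x ≤ y → (∀ k → x ≤ k → k < y → f (suc k) ≡ f k) → f y ≡ f x
  constant-on f {y = zero}  z≤n  same = refl
  constant-on f {x} {suc y} x≤sy same with m≤n⇒m<n∨m≡n x≤sy
  ... | inj₂ refl = refl
  ... | inj₁ x≤y  = trans (same y (s≤s⁻¹ x≤y) ≤-refl) (constant-on f (s≤s⁻¹ x≤y) λ k x≤k k<y → same k x≤k
      (m<n⇒m<1+n k<y))

  entry : ∀ {P : Pred ℕ 0ℓ} → Decidable P → ∀ {x y} → x ≤ y → ¬ P x → P y →
      ∃[ k ] (x ≤ k × k < y × ¬ P k × P (suc k))
  entry P? {y = zero}  z≤n  ¬p p = contradiction p ¬p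
  entry P? {x} {suc y} x≤sy ¬p p with m≤n⇒m<n∨m≡n x≤sy
  ... | inj₂ refl = contradiction p ¬p
  ... | inj₁ x≤y with P? y
  ...   | no ¬q = y , s≤s⁻¹ x≤y , ≤-refl , ¬q , p
  ...   | yes q with entry P? (s≤s⁻¹ x≤y) ¬p q
  ...     | k , x≤k , k<y , ¬pk , psk = k , x≤k , m<n⇒m<1+n k<y , ¬pk , psk

  module LowDegree {n} (G : Graph n) (R : Rotation G) (S : Spherical G R) (r : Fin n) where
    open Graph G
    open Forest G R S r

    -- If depth u exceeds depth x, then the difference is truncated to 0, and the
    -- equation x ≡ u fails.
    Anc : Fin n → Fin n → Set
    Anc u x = iterate parent x (depth x ∸ depth u) ≡ u

    anc? : ∀ u x → Dec (Anc u x)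
    anc? u x = _ ≟ u

    anc-refl : ∀ {u} → Anc u u
    anc-refl {u} = cong (iterate parent u) (n∸n≡0 (depth u))

    anc-root : ∀ {u ρ} → ρ ≡ root ρ → Anc u ρ → u ≡ ρ
    anc-root {u} {ρ} isRoot anc =
      sym (subst (λ k → iterate parent ρ k ≡ u)
          (trans (cong (_∸ depth u) (depth-root isRoot)) (0∸n≡0 (depth u))) anc)

    anc-up : ∀ {u x} → Anc u x → u ≡ x ⊎ Anc u (parent x)
    anc-up {u} {x} anc with parent-spec x
    ... | inj₁ (isRoot , _) = inj₁ (anc-root isRoot anc)
    ... | inj₂ (_ , eq) with depth u ≤? depth (parent x)
    ...   | yes u≤ = inj₂ (subst (λ k → iterate parent x k ≡ u)
        (trans (cong (_∸ depth u) eq) (+-∸-assoc 1 u≤)) anc)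
    ...   | no u≰  = inj₁ (sym (subst (λ k → iterate parent x k ≡ u)
        (trans (cong (_∸ depth u) eq) (m≤n⇒m∸n≡0 (≰⇒> u≰))) anc))

    anc-down : ∀ {u x} → Anc u (parent x) → Anc u x
    anc-down {u} {x} anc with parent-spec x
    ... | inj₁ (_ , eq) = subst (Anc u) eq anc
    ... | inj₂ (_ , eq) with depth u ≤? depth (parent x)
    ...   | yes u≤ = subst (λ k → iterate parent x k ≡ u)
        (sym (trans (cong (_∸ depth u) eq) (+-∸-assoc 1 u≤))) anc
    ...   | no u≰  = contradiction (≤-reflexive (cong depth (sym
              (subst (λ k → iterate parent (parent x) k ≡ u) (m≤n⇒m∸n≡0 (<⇒≤ (≰⇒> u≰))) anc)))) u≰

    depth-0⇒root : ∀ {u} → depth u ≡ 0 → u ≡ root u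
    depth-0⇒root {u} eq with parent-spec u
    ... | inj₁ (isRoot , _) = isRoot
    ... | inj₂ (_ , eq′)    = contradiction (trans (sym eq) eq′) λ ()

    -- A vertex of depth t burns at time t at the earliest, and each of the paths
    -- to x and y has one vertex of this depth.
    module Defence (x y : Fin n) {Z : Pred (Fin n) 0ℓ} (Z? : Decidable Z) where

      OnPath : Pred (Fin n) 0ℓ
      OnPath u = Anc u x ⊎ Anc u y

      onPath? : Decidable OnPath
      onPath? u = anc? u x ⊎-dec anc? u y

      First : Pred (Fin n) 0ℓ
      First w = Adj r w × (OnPath w ⊎ Z w)

      first? : Decidable First
      first? w = adj? r w ×-dec (onPath? w ⊎-dec Z? w)

      module _ (separated : ∀ {u w} → u ≢ r → w ≢ r → ¬ OnPath u → ¬ OnPath w → Adj u w → ¬ Z u → ¬ Z w)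
               (first≤2 : count first? ≤ 2) where

        Chosen : ℕ → Pred (Fin n) 0ℓ
        Chosen zero    w = First w
        Chosen (suc t) w = depth w ≡ suc (suc t) × OnPath w

        chosen? : ∀ t → Decidable (Chosen t)
        chosen? zero    w = first? w
        chosen? (suc t) w = depth w ℕ.≟ suc (suc t) ×-dec onPath? w

        σ : Strategy n
        σ t = ⟨ chosen? t ⟩

        open Process G ⁅ r ⁆ ∅ σ

        chosen-protected : ∀ {s t w} → s < t → Chosen s w → w ∈ protected t
        chosen-protected {s} {suc t} s<t c with m≤n⇒m<n∨m≡n (s≤s⁻¹ s<t)
        ... | inj₁ s<t′ = p⊆p∪q (σ t) (chosen-protected s<t′ c)
        ... | inj₂ refl = q⊆p∪q (protected t) (σ t) (∈⟨⟩⁺ (chosen? t) c)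

        Burnable : ℕ → Pred (Fin n) 0ℓ
        Burnable t w = (w ≡ r ⊎ (¬ OnPath w × ¬ Z w)) × depth w ≤ t × root w ≡ r

        burnable : ∀ t {w} → w ∈ burning t → Burnable t w
        burnable zero w∈ with x∈⁅y⁆⇒x≡y r w∈
        ... | refl = inj₁ refl , ≤-reflexive (depth-root (sym root-r)) , root-r
        burnable (suc t) {w} w∈ with spread⁻ G (burning t) (protected (suc t)) w∈
        ... | inj₁ old with burnable t old
        ...   | safe , d≤ , rt = safe , m≤n⇒m≤1+n d≤ , rt
        burnable (suc t) {w} w∈ | inj₂ (w∉ , u , u∈ , uw) with burnable t u∈
        ... | u-safe , d≤ , rt = safe , depth≤ , root-w
          where
          depth≤ : depth w ≤ suc t
          depth≤ = ≤-trans (depth-adj uw) (s≤s d≤)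
          root-w : root w ≡ r
          root-w = trans (sym (root-adj uw)) rt
          off-path : w ≢ r → ¬ OnPath w
          off-path w≢ on with parent-spec w
          ... | inj₁ (isRoot , _) = w≢ (trans isRoot root-w)
          ... | inj₂ (a , eq) with depth (parent w) in eq′
          ...   | zero = w∉ (chosen-protected {0} {suc t} z<s (adj-sym (subst (Adj w) parent≡r a) , inj₁ on))
            where
            parent≡r : parent w ≡ r
            parent≡r = trans (depth-0⇒root eq′) (trans (sym (root-adj a)) root-w)
          -- The depth of `w` is `k + 2`, so `w` is protected at time `k + 2`, which is at most
          -- `t + 1`.
          ...   | suc k = w∉ (chosen-protected {suc k} {suc t} (subst (_≤ suc t) eq depth≤) (eq , on))
          unsaved : u ≡ r ⊎ (¬ OnPath u × ¬ Z u) → w ≢ r → ¬ Z w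
          unsaved (inj₁ eq) _ z = w∉ (chosen-protected {0} {suc t} z<s (subst (λ u → Adj u w) eq uw , inj₂ z))
          unsaved (inj₂ (¬on , ¬z)) w≢ z with u ≟ r
          ... | yes eq = w∉ (chosen-protected {0} {suc t} z<s (subst (λ u → Adj u w) eq uw , inj₂ z))
          ... | no u≢  = separated u≢ w≢ ¬on (off-path w≢) uw ¬z z
          safe : w ≡ r ⊎ (¬ OnPath w × ¬ Z w)
          safe with w ≟ r
          ... | yes eq = inj₁ eq
          ... | no w≢  = inj₂ (off-path w≢ , unsaved u-safe w≢)

        chosen≤2 : ∀ t → count (chosen? t) ≤ 2
        chosen≤2 zero    = first≤2
        chosen≤2 (suc t) = count≤length (chosen? (suc t))
          (iterate parent x (depth x ∸ suc (suc t)) ∷ iterate parent y (depth y ∸ suc (suc t)) ∷ [])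
          λ { {w} (eq , inj₁ anc) → here (trans (sym anc) (cong (λ k → iterate parent x (depth x ∸ k)) eq))
            ; {w} (eq , inj₂ anc) → there
                (here (trans (sym anc) (cong (λ k → iterate parent y (depth y ∸ k)) eq))) }

        chosen-unburnt : ∀ t {w} → Chosen t w → w ∉ burning t
        chosen-unburnt zero    (a , _)  w∈ = loopless G (subst (Adj r) (x∈⁅y⁆⇒x≡y r w∈) a)
        chosen-unburnt (suc t) (eq , _) w∈ with burnable (suc t) w∈
        ... | _ , d≤ , _ = 1+n≰n (subst (_≤ suc t) eq d≤)

        legal : Legal 2
        legal t = subst (_≤ 2) (sym (∣⟨⟩∣ (chosen? t))) (chosen≤2 t) ,
                  λ w∈ → x∉p⇒x∈∁p (chosen-unburnt t (∈⟨⟩⁻ (chosen? t) w∈))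

        defended : count Z? ≤ suc (sn 2 G r)
        defended = ≤-trans
          (count-⊎ Z? (_≟ r) (λ w → Z? w ×-dec ¬? (w ≟ r)) split)
          (+-mono-≤ (count-singleton (_≟ r) λ { refl refl → refl })
                    (saves G r σ legal (λ w → Z? w ×-dec ¬? (w ≟ r)) unburnt))
          where
          split : ∀ {w} → Z w → w ≡ r ⊎ (Z w × w ≢ r)
          split {w} z with w ≟ r
          ... | yes eq = inj₁ eq
          ... | no ≢   = inj₂ (z , ≢)
          unburnt : ∀ t {w} → Z w × w ≢ r → w ∉ burning t
          unburnt t (z , ≢) w∈ with burnable t w∈
          ... | inj₁ eq , _        = ≢ eq
          ... | inj₂ (_ , ¬z) , _ = ¬z z

    -- For a small component, where doing nothing saves all the rest.
    unprotected : ∀ {Z : Pred (Fin n) 0ℓ} (Z? : Decidable Z) → Z r → (∀ {u w} → Adj u w → Z u → Z w) →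
        n ≤ count Z? + sn 2 G r
    unprotected {Z} Z? z-r closed = subst (_≤ count Z? + sn 2 G r) (count-∁ Z?)
      (+-monoʳ-≤ (count Z?) (saves G r (idle G 2) (idle-legal G 2 ⁅ r ⁆ ∅) (λ w → ¬? (Z? w)) λ t ¬z w∈ → ¬z
          (burnt t w∈)))
      where
      open Process G ⁅ r ⁆ ∅ (idle G 2)
      burnt : ∀ t {w} → w ∈ burning t → Z w
      burnt zero w∈ with x∈⁅y⁆⇒x≡y r w∈
      ... | refl = z-r
      burnt (suc t) w∈ with spread⁻ G (burning t) (protected (suc t)) w∈
      ... | inj₁ old                = burnt t old
      ... | inj₂ (_ , u , u∈ , uw) = closed uw (burnt t u∈)

    module Tour {w₀} (a₀ : Adj r w₀) where

      private module Orbit = Period _≟ᴰ_ κ κ-injective (r , w₀)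
      open Orbit using () renaming (period to L; fold-injective to positions-injective)

      d : ℕ → D
      d = fold (r , w₀) κ

      s : ℕ → Fin n
      s k = proj₁ (d k)

      d-dart : ∀ k → IsDart (d k)
      d-dart zero    = a₀
      d-dart (suc k) = κ-dart (d-dart k)

      d-L : d L ≡ d 0
      d-L = Orbit.fold-period

      s-tree : ∀ k → Tree (d k) → s (suc k) ≡ proj₂ (d k)
      s-tree k t = cong proj₁ (κ-tree t)

      s-chord : ∀ k → ¬ Tree (d k) → s (suc k) ≡ s k
      s-chord k ¬t = cong proj₁ (κ-chord ¬t)

      root-s : ∀ k → root (s k) ≡ r
      root-s zero = root-r
      root-s (suc k) with tree? (d k)
      ... | yes t = trans (cong root (s-tree k t)) (trans (sym (root-adj (d-dart k))) (root-s k))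
      ... | no ¬t = trans (cong root (s-chord k ¬t)) (root-s k)

      opaque
        position : ∀ {u w} → Adj u w → root u ≡ r → ∃[ k ] (k < L × d k ≡ (u , w))
        position {u} a eq with Contour.visits (λ e → ∃[ k ] d k ≡ e) (λ { _ (k , refl) → suc k , refl })
                                 (λ _ → w₀ , a₀ , 0 , refl) (depth u) refl eq a
        ... | k , dk≡ with Orbit.fold-reduce k
        ...   | i , i< , eq′ = i , i< , trans eq′ dk≡

      face-tree : ∀ k → Tree (d k) → face (d (suc k)) ≡ face (d k)
      face-tree k t = trans (cong face (κ-tree t)) (face-φ (d-dart k))

      face-chord : ∀ k → ¬ Tree (d k) → face (d (suc k)) ≡ face (rev (d k))
      face-chord k ¬t = trans (cong face (κ-chord ¬t)) (face-φ (adj-sym (d-dart k)))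

      -- The corners at `i` and `j` belong to one face, so a curve joining them inside it would
      -- cross no edge.
      Free : ℕ → ℕ → Set
      Free i j = face (d i) ≡ face (d j)

      opaque
        -- With the classes of `separation`, the class of the current face changes only where the
        -- tour crosses the chord of `d k`, in either direction. Since the tour has the same face at
        -- `i` and at `j`, one crossing between them forces the other.
        non-crossing : ∀ {i j k} → Free i j → j ≤ L → i ≤ k → k < j → ¬ Tree (d k) →
                       ∃[ l ] (i ≤ l × l < j × d l ≡ rev (d k))
        non-crossing {i} {j} {k} free j≤L i≤k k<j ¬t =
          l , decidable-stable (i ≤? l) (λ i≰l → outside λ (i≤l , _) → i≰l i≤l) ,
          decidable-stable (l <? j) (λ l≮j → outside λ (_ , l<j) → l≮j l<j) , dl≡
          where
          opposite : ∃[ l ] (l < L × d l ≡ rev (d k))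
          opposite = position (adj-sym (d-dart k)) (trans (sym (root-adj (d-dart k))) (root-s k))
          l : ℕ
          l = proj₁ opposite
          l<L : l < L
          l<L = proj₁ (proj₂ opposite)
          dl≡ : d l ≡ rev (d k)
          dl≡ = proj₂ (proj₂ opposite)
          open Separation (separation (d-dart k) ¬t)
          outside : ¬ ¬ (i ≤ l × l < j)
          outside out = differ (begin
            class (face (d k))
                ≡⟨ constant-on (class ∘ face ∘ d) i≤k (λ m i≤m m<k → steady i≤m (<-trans m<k k<j) (<⇒≢ m<k)) ⟩
            class (face (d i))        ≡⟨ cong class free ⟩
            class (face (d j))
                ≡⟨ constant-on (class ∘ face ∘ d) k<j (λ m k<m m<j → steady (≤-trans i≤k (<⇒≤ k<m)) m<j
                (>⇒≢ k<m)) ⟩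
            class (face (d (suc k)))  ≡⟨ cong class (face-chord k ¬t) ⟩
            class (face (rev (d k)))  ∎)
            where
            open ≡-Reasoning
            steady : ∀ {m} → i ≤ m → m < j → m ≢ k → class (face (d (suc m))) ≡ class (face (d m))
            steady {m} i≤m m<j m≢k with tree? (d m)
            ... | yes t  = cong class (face-tree m t)
            ... | no ¬t′ = trans (cong class (face-chord m ¬t′)) (sym (agree (d-dart m) ¬t′
              (m≢k ∘ positions-injective (<-≤-trans m<j j≤L) (<-≤-trans k<j j≤L))
              λ eq → out (subst (λ l → i ≤ l × l < j)
                  (positions-injective (<-≤-trans m<j j≤L) l<L (trans eq (sym dl≡))) (i≤m , m<j))))

      enters : ∀ {u} k → ¬ Anc u (s k) → Anc u (s (suc k)) → d k ≡ (parent u , u)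
      enters {u} k ¬anc anc with tree? (d k)
      ... | no ¬t = contradiction (subst (Anc u) (s-chord k ¬t) anc) ¬anc
      ... | yes (inj₁ eq) = contradiction (anc-down (subst (Anc u) (trans (s-tree k (inj₁ eq)) (sym eq)) anc))
          ¬anc
      ... | yes (inj₂ eq) with anc-up (subst (Anc u) (s-tree k (inj₂ eq)) anc)
      ...   | inj₁ u≡  = cong₂ _,_ (sym (trans (cong parent u≡) eq)) (sym u≡)
      ...   | inj₂ anc′ = contradiction (subst (Anc u) eq anc′) ¬anc

      -- The tour enters a subtree only once.
      opaque
        convex : ∀ {u} → u ≢ r → ∀ {x k y} → x ≤ k → k ≤ y → y ≤ L → Anc u (s x) → Anc u (s y) → Anc u (s k)
        convex {u} u≢r {x} {k} {y} x≤k k≤y y≤L ancx ancy = decidable-stable (anc? u (s k)) twice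
          where
          -- The tour starts outside the subtree, at `r`, so it enters once before `x` and again
          -- between `k` and `y`, by the same dart at two positions below `L`.
          twice : ¬ ¬ Anc u (s k)
          twice ¬anc
            with k₁ , _ , k₁<x , out₁ , in₁ ← entry (λ m → anc? u (s m)) (z≤n {x})
                (u≢r ∘ anc-root (sym root-r)) ancx
               | k₂ , k≤k₂ , k₂<y , out₂ , in₂ ← entry (λ m → anc? u (s m)) k≤y ¬anc ancy =
            <⇒≢ k₁<k₂ (positions-injective (<-trans k₁<k₂ k₂<L) k₂<L
              (trans (enters k₁ out₁ in₁) (sym (enters k₂ out₂ in₂))))
            where
            k₁<k₂ : k₁ < k₂
            k₁<k₂ = <-≤-trans k₁<x (≤-trans x≤k k≤k₂)
            k₂<L : k₂ < L
            k₂<L = <-≤-trans k₂<y y≤L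

      Inside : ℕ → ℕ → Pred (Fin n) 0ℓ
      Inside i j u = ∃[ k ] (k < suc j × i ≤ k × s k ≡ u)

      inside? : ∀ i j → Decidable (Inside i j)
      inside? i j u = anyUpTo? (λ k → i ≤? k ×-dec s k ≟ u) (suc j)

      weight : ℕ → ℕ → ℕ
      weight i j = count (inside? i j)

      module Region {i j} (i≤j : i ≤ j) (j≤L : j ≤ L) (free : Free i j) where

        OnPath : Pred (Fin n) 0ℓ
        OnPath u = Anc u (s i) ⊎ Anc u (s j)

        -- A visit to `u` within the interval and one beyond it would, by `convex`, put `s i` or
        -- `s j` into the subtree of `u`, and hence `u` onto a path.
        in-and-out : ∀ {u k l} → u ≢ r → i ≤ k → k ≤ j → s k ≡ u → l < L → s l ≡ u → ¬ OnPath u →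
            i ≤ l × l ≤ j
        in-and-out {u} {k} {l} u≢r i≤k k≤j sk l<L sl ¬on =
          decidable-stable (i ≤? l)
              (λ i≰l → ¬on (inj₁ (convex u≢r (<⇒≤ (≰⇒> i≰l)) i≤k (≤-trans k≤j j≤L) (at l sl) (at k sk)))) ,
          decidable-stable (l ≤? j)
              (λ l≰j → ¬on (inj₂ (convex u≢r k≤j (<⇒≤ (≰⇒> l≰j)) (<⇒≤ l<L) (at k sk) (at l sl))))
          where
          at : ∀ m → s m ≡ u → Anc u (s m)
          at m refl = anc-refl

        -- By `in-and-out`, the tour has the dart from `u` to `w` within the interval. A tree edge
        -- takes it to `w` in the next step; for a chord, the reverse dart, with source `w`, lies in
        -- the interval by `non-crossing`.
        separated : ∀ {u w} → u ≢ r → ¬ OnPath u → Adj u w → Inside i j u → Inside i j w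
        separated {u} {w} u≢r ¬on a (k , k≤j , i≤k , sk) with position a
            (trans (cong root (sym sk)) (root-s k))
        ... | l , l<L , dl with in-and-out u≢r i≤k (s≤s⁻¹ k≤j) sk l<L (cong proj₁ dl) ¬on
        ...   | i≤l , l≤j with m≤n⇒m<n∨m≡n l≤j
        ...     | inj₂ refl = contradiction (inj₂ (subst (Anc u) (sym (cong proj₁ dl)) anc-refl)) ¬on
        ...     | inj₁ l<j with tree? (d l)
        ...       | yes t = suc l , s≤s l<j , m≤n⇒m≤1+n i≤l , trans (s-tree l t) (cong proj₂ dl)
        ...       | no ¬t with non-crossing free j≤L i≤l l<j ¬t
        ...         | m , i≤m , m<j , dm = m , m<n⇒m<1+n m<j , i≤m , trans (cong proj₁ dm) (cong proj₂ dl)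

        -- The inside and the outside both have at least `t` vertices, so either may be defended,
        -- and the one with the cheaper first step is.
        region-saved : ∀ {t} → t ≤ weight i j → weight i j + t ≤ n → Low G r → t ≤ suc (sn 2 G r)
        region-saved {t} t≤ ≤n low = conclude (count In.first? ≤? 2) (count Out.first? ≤? 2)
          where
          outside? : Decidable (λ u → ¬ Inside i j u)
          outside? u = ¬? (inside? i j u)

          module In  = Defence (s i) (s j) (inside? i j)
          module Out = Defence (s i) (s j) outside?

          near? : Decidable (λ w → Adj r w × OnPath w)
          near? w = adj? r w ×-dec In.onPath? w

          near≤2 : count near? ≤ 2
          near≤2 = count≤length near? (iterate parent (s i) (depth (s i) ∸ 1) ∷ iterate parent (s j)
              (depth (s j) ∸ 1) ∷ [])
            λ { (a , inj₁ anc) → here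
                (trans (sym anc) (cong (λ k → iterate parent (s i) (depth (s i) ∸ k)) (depth-1 a)))
              ; (a , inj₂ anc) → there (here
                  (trans (sym anc) (cong (λ k → iterate parent (s j) (depth (s j) ∸ k)) (depth-1 a)))) }
            where
            depth-1 : ∀ {w} → Adj r w → depth w ≡ 1
            depth-1 {w} a with depth w in eq | subst (depth w ≤_) (cong suc (depth-root (sym root-r)))
                (depth-adj a)
            ... | suc zero | _ = refl
            ... | suc (suc _) | s≤s ()
            ... | zero | _ = contradiction
                (subst (Adj r) (trans (depth-0⇒root eq) (trans (sym (root-adj a)) root-r)) a) (loopless G)

          -- Both first steps protect the neighbours on the paths, and only one of
          -- them protects any other neighbour.
          both≤5 : count In.first? + count Out.first? ≤ 5
          both≤5 = ≤-trans
            (count-inclusion-exclusion In.first? Out.first? (adj? r) near? proj₁ proj₁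
              λ { (a , inj₁ on) _ → a , on ; _ (a , inj₁ on) → a , on ; (_ , inj₂ in′)
                  (_ , inj₂ out) → contradiction in′ out })
            (+-mono-≤ low near≤2)

          conclude : Dec (count In.first? ≤ 2) → Dec (count Out.first? ≤ 2) → t ≤ suc (sn 2 G r)
          conclude (yes few) _ = ≤-trans t≤ (In.defended
            (λ _ w≢r _ ¬on a ¬in in′ → ¬in (separated w≢r ¬on (adj-sym a) in′)) few)
          conclude (no _) (yes few) = ≤-trans
            (+-cancelˡ-≤ (weight i j) t (count outside?)
                (subst (weight i j + t ≤_) (sym (count-∁ (inside? i j))) ≤n))
            (Out.defended (λ u≢r _ ¬on _ a ¬out out → ¬out λ in′ → out (separated u≢r ¬on a in′)) few)
          conclude (no many) (no many′) = contradiction (+-mono-≤ (≰⇒> many) (≰⇒> many′)) (<⇒≱ (s≤s both≤5))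

      record Balanced (t : ℕ) : Set where
        field
          {i j}  : ℕ
          i≤j    : i ≤ j
          j≤L    : j ≤ L
          free   : Free i j
          heavy  : t ≤ weight i j
          light  : weight i j ≤ 2 * t

      -- While more than `2 * t` vertices are visited, the interval shrinks, its length being
      -- bounded by `m`. A tree edge at its start is cut off, at the cost of at most one vertex. A
      -- chord at its start splits the rest, at its reverse, into two intervals that are free again
      -- and one of which visits at least `t` vertices.
      balance : ∀ {t} → 1 ≤ t → ∀ m {i j} → j ∸ i ≤ m → i ≤ j → j ≤ L → Free i j → t ≤ weight i j → Balanced t
      balance {t} 1≤t m {i} {j} fuel i≤j j≤L free heavy with weight i j ≤? 2 * t
      ... | yes light = record { i≤j = i≤j ; j≤L = j≤L ; free = free ; heavy = heavy ; light = light }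
      ... | no ≰light with m≤n⇒m<n∨m≡n i≤j
      ...   | inj₂ refl = contradiction
          (≤-trans (count-singleton (inside? i i) point) (≤-trans 1≤t (m≤m+n t _))) ≰light
        where
        point : ∀ {u w} → Inside i i u → Inside i i w → u ≡ w
        point (k , k≤ , ≤k , sk) (l , l≤ , ≤l , sl) =
          trans (sym sk) (trans (cong s (trans (≤-antisym (s≤s⁻¹ k≤) ≤k) (sym (≤-antisym (s≤s⁻¹ l≤) ≤l)))) sl)
      balance {t} 1≤t zero {i} {j} fuel i≤j j≤L free heavy | no ≰light | inj₁ i<j =
        contradiction (m∸n≡0⇒m≤n (n≤0⇒n≡0 fuel)) (<⇒≱ i<j)
      balance {t} 1≤t (suc m) {i} {j} fuel i≤j j≤L free heavy | no ≰light | inj₁ i<j = divide (tree? (d i))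
        where
        shrink : ∀ {i′ j′} → i < i′ → j′ ≤ j → j′ ∸ i′ ≤ m
        shrink {i′} {j′} i<i′ j′≤j = ≤-trans (∸-mono j′≤j i<i′)
          (subst (_≤ m) (pred[m∸n]≡m∸[1+n] j i) (pred-mono-≤ fuel))

        2t< : 2 * t < weight i j
        2t< = ≰⇒> ≰light

        divide : Dec (Tree (d i)) → Balanced t
        divide (yes tr) = balance 1≤t m (shrink ≤-refl ≤-refl) i<j j≤L (trans (face-tree i tr) free) heavy′
          where
          split : ∀ {u} → Inside i j u → u ≡ s i ⊎ Inside (suc i) j u
          split (k , k≤j , i≤k , sk) with m≤n⇒m<n∨m≡n i≤k
          ... | inj₁ i<k  = inj₂ (k , k≤j , i<k , sk)
          ... | inj₂ refl = inj₁ (sym sk)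
          heavy′ : t ≤ weight (suc i) j
          heavy′ = s≤s⁻¹ (begin
            suc t                                          ≤⟨ s≤s (m≤m+n t _) ⟩
            suc (2 * t)                                    ≤⟨ 2t< ⟩
            weight i j
                ≤⟨ count-⊎ (inside? i j) (_≟ s i) (inside? (suc i) j) split ⟩
            count (_≟ s i) + weight (suc i) j
                ≤⟨ +-monoˡ-≤ (weight (suc i) j) (count-singleton (_≟ s i) λ { refl refl → refl }) ⟩
            suc (weight (suc i) j)                         ∎)
            where open ≤-Reasoning
        divide (no ¬t) with non-crossing free j≤L ≤-refl i<j ¬t
        ... | l , i≤l , l<j , dl with m≤n⇒m<n∨m≡n i≤l
        ...   | inj₂ refl = contradiction (subst (Adj (s i)) (sym (cong proj₁ dl)) (d-dart i)) (loopless G)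
        ...   | inj₁ i<l with t ≤? weight (suc i) l
        ...     | yes heavy′ = balance 1≤t m (shrink ≤-refl (<⇒≤ l<j)) i<l (<⇒≤ (<-≤-trans l<j j≤L))
                                 (trans (face-chord i ¬t) (cong face (sym dl))) heavy′
        ...     | no ≱t = balance 1≤t m (shrink (s≤s i≤l) ≤-refl) l<j j≤L
                                 (trans (face-chord l (¬t ∘ Sum.swap ∘ subst Tree dl))
                                     (trans (cong (face ∘ rev) dl) free)) heavy′
          where
          split : ∀ {u} → Inside i j u → Inside (suc i) l u ⊎ Inside (suc l) j u
          split (k , k≤j , i≤k , sk) with k ≤? l | m≤n⇒m<n∨m≡n i≤k
          ... | no k≰l  | _         = inj₂ (k , k≤j , ≰⇒> k≰l , sk)
          ... | yes k≤l | inj₁ i<k  = inj₁ (k , s≤s k≤l , i<k , sk)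
          -- The tour stays in place at a chord, so dropping position `i` loses no vertex.
          ... | yes _   | inj₂ refl = inj₁ (suc i , s≤s i<l , ≤-refl , trans (s-chord i ¬t) sk)
          heavy′ : t ≤ weight (suc l) j
          heavy′ = +-cancelˡ-≤ t t _ (begin
            t + t                                   ≡⟨ cong (t +_) (+-identityʳ t) ⟨
            2 * t                                   ≤⟨ <⇒≤ 2t< ⟩
            weight i j
                ≤⟨ count-⊎ (inside? i j) (inside? (suc i) l) (inside? (suc l) j) split ⟩
            weight (suc i) l + weight (suc l) j     ≤⟨ +-monoˡ-≤ (weight (suc l) j) (<⇒≤ (≰⇒> ≱t)) ⟩
            t + weight (suc l) j                    ∎)
            where open ≤-Reasoning

      saved : ∀ {t} → 1 ≤ t → 3 * t ≤ n → Low G r → t ≤ suc (sn 2 G r)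
      saved {t} 1≤t 3t≤n low with t ≤? weight 0 L
      ... | yes heavy = Region.region-saved i≤j j≤L free heavy′ enough low
        where
        -- The descent starts from the whole tour, which is free because it is closed.
        open Balanced (balance 1≤t L ≤-refl z≤n ≤-refl (sym (cong face d-L)) heavy) renaming (heavy to heavy′)
        enough : weight i j + t ≤ n
        enough = ≤-trans (+-monoˡ-≤ t light) (≤-trans (≤-reflexive (+-comm (2 * t) t)) 3t≤n)
      -- The component of `r` has fewer than `t` vertices, and the rest is out of reach of the fire.
      ... | no ≱t = m≤n⇒m≤1+n (+-cancelˡ-≤ t t (sn 2 G r) (begin
        t + t                        ≤⟨ +-monoʳ-≤ t (m≤m+n t _) ⟩
        3 * t                        ≤⟨ 3t≤n ⟩
        n                            ≤⟨ unprotected component? root-r (λ a → trans (sym (root-adj a))) ⟩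
        count component? + sn 2 G r
            ≤⟨ +-monoˡ-≤ (sn 2 G r) (≤-trans (count-mono component? (inside? 0 L) visited) (<⇒≤ (≰⇒> ≱t))) ⟩
        t + sn 2 G r                 ∎))
        where
        open ≤-Reasoning
        component? : Decidable (λ u → root u ≡ r)
        component? u = root u ≟ r
        visited : ∀ {u} → root u ≡ r → Inside 0 L u
        visited {u} eq with parent-spec u
        ... | inj₁ (isRoot , _) = 0 , z<s , z≤n , sym (trans isRoot eq)
        ... | inj₂ (a , _) with position a eq
        ...   | k , k<L , dk = k , m<n⇒m<1+n k<L , z≤n , cong proj₁ dk

    saved : ∀ {t} → 1 ≤ t → 3 * t ≤ n → Low G r → t ≤ suc (sn 2 G r)
    saved {t} 1≤t 3t≤n low with any? (adj? r)
    ... | yes (_ , a)   = Tour.saved a 1≤t 3t≤n low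
    ... | no isolated = begin
      t                          ≤⟨ m≤m+n t _ ⟩
      3 * t                      ≤⟨ 3t≤n ⟩
      n                          ≤⟨ unprotected (_≟ r) refl (λ { a refl → contradiction (_ , a) isolated }) ⟩
      count (_≟ r) + sn 2 G r    ≤⟨ +-monoˡ-≤ (sn 2 G r) (count-singleton (_≟ r) λ { refl refl → refl }) ⟩
      suc (sn 2 G r)             ∎
      where open ≤-Reasoning

  -- Averaging

  opaque
    unfolding ∑

    sum-allFin : ∀ {n} (f : Fin n → ℕ) → ℕ-sum (List.map f (allFin n)) ≡ ∑ f
    sum-allFin f = trans (cong ℕ-sum (map-tabulate id f)) (sum-tabulate f)
      where
      sum-tabulate : ∀ {n} (f : Fin n → ℕ) → ℕ-sum (List.tabulate f) ≡ ∑ f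
      sum-tabulate {zero}  f = refl
      sum-tabulate {suc n} f = cong (f zero +_) (sum-tabulate (f ∘ suc))

  -- This settles the graphs with fewer than 24 vertices.
  save-one : ∀ {n} (G : Graph n) → 1 < n → ∀ v → 1 ≤ sn 2 G v
  save-one {suc zero}    G (s≤s ()) v
  save-one {suc (suc n)} G _ v = ≤-trans (count-positive (_≟ w) refl)
    (saves G v (λ _ → ⁅ w ⁆) legal (_≟ w) λ { t refl → unburnt t })
    where
    w = punchIn v zero
    open Process G ⁅ v ⁆ ∅ (λ _ → ⁅ w ⁆)
    unburnt : ∀ t → w ∉ burning t
    unburnt zero w∈ = punchInᵢ≢i v zero (x∈⁅y⁆⇒x≡y v w∈)
    unburnt (suc t) w∈ with spread⁻ G (burning t) (protected (suc t)) w∈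
    ... | inj₁ old      = unburnt t old
    ... | inj₂ (w∉ , _) = w∉ (q⊆p∪q (protected t) ⁅ w ⁆ (x∈⁅x⁆ w))
    legal : Legal 2
    legal t = ≤-trans (≤-reflexive (∣⁅x⁆∣≡1 w)) (s≤s z≤n) ,
              λ u∈ → x∉p⇒x∈∁p (subst (_∉ burning t) (sym (x∈⁅y⁆⇒x≡y w u∈)) (unburnt t))

  module _ {n} (G : Graph n) (R : Rotation G) (S : Spherical G R) (triangle-free : TriangleFree G)
      (v₀ : Fin n) where
    open Graph G
    open Sphere G R S v₀
    open Grid G R

    Central : Pred (Fin n) 0ℓ
    Central v = ∃[ d ] ((IsDart d × ¬ Irregular d) × proj₁ (centre d) ≡ v)

    central? : Decidable Central
    central? v = any-finite? λ d → (dart? d ×-dec ¬? (irregular? d)) ×-dec proj₁ (centre d) ≟ v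

    Safe : Pred (Fin n) 0ℓ
    Safe v = Low G v ⊎ Central v

    safe? : Decidable Safe
    safe? v = low? G v ⊎-dec central? v

    -- The threshold comes from the grid: `n ≤ 4 * (n ∸ 18)` holds from 24 on. For a low vertex and
    -- `q = n / 3`, rounded down, `2 + 3 * q ≤ 4 * (q ∸ 1)` only takes `6 ≤ q`.
    safe-sn : 24 ≤ n → ∀ {v} → Safe v → n ≤ 4 * sn 2 G v
    safe-sn 24≤n {v} (inj₁ low) = begin
      n                          ≡⟨ m≡m%n+[m/n]*n n 3 ⟩
      n % 3 + n / 3 * 3          ≤⟨ +-monoˡ-≤ (n / 3 * 3) (s≤s⁻¹ (m%n<n n 3)) ⟩
      2 + n / 3 * 3              ≤⟨ +-cancelˡ-≤ 4 _ _ bound ⟩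
      4 * sn 2 G v               ∎
      where
      open ≤-Reasoning
      6≤n/3 : 6 ≤ n / 3
      6≤n/3 = ≤-trans (toWitness {a? = 6 ≤? 8} _) (/-monoˡ-≤ 3 24≤n)
      third : n / 3 ≤ suc (sn 2 G v)
      third = LowDegree.saved G R S v (≤-trans (s≤s z≤n) 6≤n/3)
          (≤-trans (≤-reflexive (*-comm 3 (n / 3))) (m/n*n≤m n 3)) low
      bound : 4 + (2 + n / 3 * 3) ≤ 4 + 4 * sn 2 G v
      bound = begin
        4 + (2 + n / 3 * 3)        ≡⟨ arrange (n / 3) ⟩
        6 + 3 * (n / 3)            ≤⟨ +-monoˡ-≤ (3 * (n / 3)) 6≤n/3 ⟩
        4 * (n / 3)                ≤⟨ *-monoʳ-≤ 4 third ⟩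
        4 * suc (sn 2 G v)         ≡⟨ *-suc 4 (sn 2 G v) ⟩
        4 + 4 * sn 2 G v           ∎
        where
        arrange : ∀ k → 4 + (2 + k * 3) ≡ 6 + 3 * k
        arrange = solve-∀
    safe-sn 24≤n {v} (inj₂ (d , (a , regular) , refl)) =
        subst (λ v → n ≤ 4 * sn 2 G v) (sym (source-centre d)) (arith (Regular.saved d a regular))
      where
      arith : ∀ {k} → n ≤ 18 + k → n ≤ 4 * k
      arith {k} n≤ = ≤-trans n≤
          (≤-trans (+-monoˡ-≤ k (*-monoʳ-≤ 3 {6} {k} (+-cancelˡ-≤ 18 6 k (≤-trans 24≤n n≤))))
                                         (≤-reflexive (+-comm (3 * k) k)))

    unsafe-darts? : Decidable (λ e → IsDart e × ¬ Safe (proj₁ e))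
    unsafe-darts? e = dart? e ×-dec ¬? (safe? (proj₁ e))

    -- As `centre` permutes the pairs, the unsafe darts can be counted as centres; a regular patch
    -- would make the source of its centre safe.
    unsafe-irregular : count unsafe-darts? ≤ count irregular?
    unsafe-irregular = ≤-trans (count-permute unsafe-darts? centre centre-injective)
      (count-mono (unsafe-darts? ∘ centre) irregular? λ {d} (a , unsafe) →
        decidable-stable (irregular? d) λ regular → unsafe (inj₂ (d , (centre-reflects a , regular) , refl)))

    -- An unsafe vertex is not low, so at least four darts start at it.
    unsafe-degree : 4 * count (λ v → ¬? (safe? v)) ≤ count unsafe-darts?
    unsafe-degree = begin
      4 * count (λ v → ¬? (safe? v))
        ≡⟨ ∑-* 4 (λ v → ind (¬? (safe? v))) ⟨
      ∑ (λ v → 4 * ind (¬? (safe? v)))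
        ≤⟨ ∑-mono fibre ⟩
      ∑ (λ v → ∑ λ e → ind (proj₁ e ≟ v) * ind (unsafe-darts? e))
        ≡⟨ ∑-fibres proj₁ (λ e → ind (unsafe-darts? e)) ⟩
      count unsafe-darts? ∎
      where
      open ≤-Reasoning
      fibre : ∀ v → 4 * ind (¬? (safe? v)) ≤ ∑ λ e → ind (proj₁ e ≟ v) * ind (unsafe-darts? e)
      fibre v = weigh (safe? v)
        where
        weigh : (safe : Dec (Safe v)) → 4 * ind (¬? safe) ≤ ∑ λ e → ind (proj₁ e ≟ v) * ind (unsafe-darts? e)
        weigh (yes _)     = z≤n
        weigh (no unsafe) = ≤-trans (≰⇒> (unsafe ∘ inj₁)) (≤-trans
          (count-injective (adj? v) (λ e → proj₁ e ≟ v ×-dec unsafe-darts? e) (v ,_) (λ a → refl , a , unsafe)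
              λ _ _ → ,-injectiveʳ)
          (∑-mono λ e → product (proj₁ e ≟ v) (unsafe-darts? e)))
          where
          product : ∀ {X Y : Set} (X? : Dec X) (Y? : Dec Y) → ind (X? ×-dec Y?) ≤ ind X? * ind Y?
          product (yes _) (yes _) = ≤-refl
          product (yes _) (no _)  = z≤n
          product (no _)  _       = z≤n

    -- Low vertices are safe, so 4 * 491 = 4 + 7 * 7 * 40 collects the darts of both kinds.
    many-safe : n ≤ 491 * count safe?
    many-safe = *-cancelˡ-≤ 4 (begin
      4 * n                                                     ≡⟨ cong (4 *_) (count-∁ safe?) ⟨
      4 * (count safe? + count (λ v → ¬? (safe? v)))            ≡⟨ *-distribˡ-+ 4 (count safe?) _ ⟩
      4 * count safe? + 4 * count (λ v → ¬? (safe? v))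
          ≤⟨ +-monoʳ-≤ (4 * count safe?) (≤-trans unsafe-degree unsafe-irregular) ⟩
      4 * count safe? + count irregular?
          ≤⟨ +-monoʳ-≤ (4 * count safe?) (count-irregular-patch (count-irregular triangle-free)) ⟩
      4 * count safe? + 7 * (7 * (40 * count (low? G)))
          ≤⟨ +-monoʳ-≤ (4 * count safe?)
          (*-monoʳ-≤ 7 (*-monoʳ-≤ 7 (*-monoʳ-≤ 40 (count-mono (low? G) safe? inj₁)))) ⟩
      4 * count safe? + 7 * (7 * (40 * count safe?))            ≡⟨ collect (count safe?) ⟩
      4 * (491 * count safe?)                                   ∎)
      where
      open ≤-Reasoning
      collect : ∀ c → 4 * c + 7 * (7 * (40 * c)) ≡ 4 * (491 * c)
      collect = solve-∀

    total : 24 ≤ n → n * n ≤ 1964 * ∑ (sn 2 G)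
    total 24≤n = begin
      n * n                                   ≤⟨ *-monoˡ-≤ n many-safe ⟩
      491 * count safe? * n                   ≡⟨ rearrange (count safe?) n ⟩
      491 * (n * count safe?)                 ≡⟨ cong (491 *_) (∑-* n (λ v → ind (safe? v))) ⟨
      491 * ∑ (λ v → n * ind (safe? v))       ≤⟨ *-monoʳ-≤ 491 (∑-mono pointwise) ⟩
      491 * ∑ (λ v → 4 * sn 2 G v)            ≡⟨ cong (491 *_) (∑-* 4 (sn 2 G)) ⟩
      491 * (4 * ∑ (sn 2 G))                  ≡⟨ *-assoc 491 4 (∑ (sn 2 G)) ⟨
      1964 * ∑ (sn 2 G)                       ∎
      where
      open ≤-Reasoning
      rearrange : ∀ c n → 491 * c * n ≡ 491 * (n * c)
      rearrange = solve-∀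
      pointwise : ∀ v → n * ind (safe? v) ≤ 4 * sn 2 G v
      pointwise v = weigh (safe? v)
        where
        weigh : (safe : Dec (Safe v)) → n * ind safe ≤ 4 * sn 2 G v
        weigh (yes safe) = ≤-trans (≤-reflexive (*-identityʳ n)) (safe-sn 24≤n safe)
        weigh (no _)     = ≤-trans (≤-reflexive (*-zeroʳ n)) z≤n

  average : ∀ n → 1 < n → (G : Graph n) → TriangleFree G → Planar G → n * n ≤ 1964 * ∑ (sn 2 G)
  average n 1<n G triangle-free (R , S) = by-size (24 ≤? n)
    where
    by-size : Dec (24 ≤ n) → n * n ≤ 1964 * ∑ (sn 2 G)
    by-size (yes 24≤n) = total G R S triangle-free (fromℕ< 1<n) 24≤n
    by-size (no 24≰n)  = *-mono-≤ {n} {1964} {n} {∑ (sn 2 G)}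
      (≤-trans (<⇒≤ (≰⇒> 24≰n)) (toWitness {a? = 24 ≤? 1964} _))
      (≤-trans (≤-reflexive (sym (trans (∑-const {Fin n} 1) (*-identityʳ n)))) (∑-mono (save-one G 1<n)))

  square≤total : ∀ n → 1 < n → (G : Graph n) → TriangleFree G → Planar G →
                 1 * n ^ 2 ≤ ℕ-sum (List.map (sn 2 G) (allFin n)) * 723636
  square≤total n 1<n G tf planar = begin
    1 * n ^ 2
        ≡⟨ trans (*-identityˡ (n ^ 2)) (cong (n *_) (*-identityʳ n)) ⟩
    n * n                                         ≤⟨ average n 1<n G tf planar ⟩
    1964 * ∑ (sn 2 G)
        ≤⟨ *-monoˡ-≤ (∑ (sn 2 G)) {1964} {723636} (toWitness {a? = 1964 ≤? 723636} _) ⟩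
    723636 * ∑ (sn 2 G)                           ≡⟨ *-comm 723636 (∑ (sn 2 G)) ⟩
    ∑ (sn 2 G) * 723636                           ≡⟨ cong (_* 723636) (sum-allFin (sn 2 G)) ⟨
    ℕ-sum (List.map (sn 2 G) (allFin n)) * 723636 ∎
    where open ≤-Reasoning

-- The bound as a comparison of rational numbers

open import Data.Integer.Base using (+_)
open import Data.Nat.Base using (ℕ; NonTrivial; nonTrivial⇒nonZero)
open import Data.Rational.Unnormalised.Base using (_/_; _≤_)

import Data.Integer.Base as ℤ
open import Data.Integer.Properties using (pos-*)
import Data.Nat.Base as ℕ
open import Data.Nat.Properties using (m^n≢0)
open import Data.Rational.Unnormalised.Base using (*≤*)
open import Relation.Binary.PropositionalEquality using (subst₂)

/-mono : ∀ a b c d → .{{_ : ℕ.NonZero b}} → .{{_ : ℕ.NonZero d}} → a ℕ.* d ℕ.≤ c ℕ.* b → + a / b ≤ + c / d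
/-mono a (ℕ.suc b) c (ℕ.suc d) le = *≤* (subst₂ ℤ._≤_ (pos-* a (ℕ.suc d)) (pos-* c (ℕ.suc b)) (ℤ.+≤+ le))

theorem4 : ∀ (n : ℕ) → .{{_ : NonTrivial n}} → (G : Graph n) → TriangleFree G → Planar G →
    + 1 / 723636 ≤ ρ {{nonTrivial⇒nonZero n}} 2 G
theorem4 n G triangle-free planar =
  /-mono 1 723636 _ (n ℕ.^ 2) {{_}} {{m^n≢0 n 2 {{nonTrivial⇒nonZero n}}}}
    (Survival.square≤total n (ℕ.nonTrivial⇒n>1 n) G triangle-free planar)
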